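{- For every even $n\ge 4$, every triangle switch chain on $\mathcal{G}_n$ is irreducible.
   Context: $\mathcal{G}_n$ is the set of simple 3-regular graphs on vertex set $[n]=\{1,\dots,n\}$. A make move ${\tt make}(yxvwz)$ applies to a graph $G=(V,E)$ when $y,x,v,w,z$ are distinct vertices, $yxvwz$ is a path in $G$ (i.e. $yx,xv,vw,wz\in E$), and $xw\notin E$, $yz\notin E$; it replaces $E$ by $(E\setminus\{xy,wz\})\cup\{xw,yz\}$, creating the triangle $vxwv$. A break move ${\tt break}(vxw,yz)$ applies when $vxwv$ is a triangle of $G$, $yz\in E$ with $\{y,z\}\cap\{v,x,w\}=\emptyset$, and $xy\notin E$, $wz\notin E$; it replaces $E$ by $(E\setminus\{xw,yz\})\cup\{xy,wz\}$. Both moves map $\mathcal{G}_n$ to $\mathcal{G}_n$; a triangle switch is a make or break move. A Markov chain on $\mathcal{G}_n$ is a triangle switch chain if its transition matrix $P$ satisfies $P(G,G')>0$ whenever $G'$ is obtained from $G$ by a single triangle switch.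
   Formalization: The transition probabilities of the Markov chain are taken to be rational numbers instead of real numbers. -}

module Defs where

open import Data.Bool using (Bool; true; false; not; _∧_; _∨_; if_then_else_; _xor_)
open import Data.Nat as ℕ using (ℕ; zero; suc; _≡ᵇ_)
open import Data.Fin using (Fin)
open import Data.Fin.Properties using () renaming (_≟_ to _≟ᶠ_)
open import Data.Vec using (Vec; []; _∷_; lookup; tabulate)
open import Data.List using (List; []; _∷_; [_]; map; concatMap; filterᵇ; allFin; foldr)
open import Data.Bool.ListAction using (and)
open import Data.Nat.ListAction using (sum)
open import Data.List.Relation.Unary.Unique.Propositional using (Unique)
open import Data.List.Membership.Propositional using (_∉_)
open import Data.Product using (Σ; _×_; _,_; ∃-syntax)
open import Data.Sum using (_⊎_)
open import Data.Rational using (ℚ; 0ℚ; 1ℚ; _+_; _<_; _≤_)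
open import Relation.Nullary using (¬_)
open import Relation.Nullary.Decidable using (⌊_⌋)
open import Relation.Binary.PropositionalEquality using (_≡_)
open import Relation.Binary.Construct.Closure.ReflexiveTransitive using (Star)

Adj : ℕ → Set
Adj n = Vec (Vec Bool n) n

entry : ∀ {n} → Adj n → Fin n → Fin n → Bool
entry A i j = lookup (lookup A i) j

Edge : ∀ {n} → Adj n → Fin n → Fin n → Set
Edge A i j = entry A i j ≡ true

isCubic : ∀ {n} → Adj n → Bool
isCubic {n} A =
  and (map (λ i →
    and (map (λ j → not (entry A i j xor entry A j i)) (allFin n))
    ∧ not (entry A i i)
    ∧ (sum (map (λ j → if entry A i j then 1 else 0) (allFin n)) ≡ᵇ 3))
    (allFin n))

Cubic : ∀ {n} → Adj n → Set
Cubic A = isCubic A ≡ true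

sameEdge : ∀ {n} → Fin n → Fin n → Fin n → Fin n → Bool
sameEdge a b i j = (⌊ i ≟ᶠ a ⌋ ∧ ⌊ j ≟ᶠ b ⌋) ∨ (⌊ i ≟ᶠ b ⌋ ∧ ⌊ j ≟ᶠ a ⌋)

rewire : ∀ {n} → Adj n → (a b c d p q r s : Fin n) → Adj n
rewire A a b c d p q r s = tabulate λ i → tabulate λ j →
  if sameEdge p q i j ∨ sameEdge r s i j then true
  else if sameEdge a b i j ∨ sameEdge c d i j then false
  else entry A i j

MakeMove : ∀ {n} → Adj n → Adj n → Set
MakeMove {n} G G' = ∃[ y ] ∃[ x ] ∃[ v ] ∃[ w ] ∃[ z ]
  ( Unique (y ∷ x ∷ v ∷ w ∷ z ∷ [])
  × Edge G y x × Edge G x v × Edge G v w × Edge G w z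
  × ¬ Edge G x w × ¬ Edge G y z
  × G' ≡ rewire G x y w z x w y z )

BreakMove : ∀ {n} → Adj n → Adj n → Set
BreakMove {n} G G' = ∃[ v ] ∃[ x ] ∃[ w ] ∃[ y ] ∃[ z ]
  ( Unique (v ∷ x ∷ w ∷ [])
  × Edge G v x × Edge G x w × Edge G w v
  × Edge G y z
  × y ∉ (v ∷ x ∷ w ∷ []) × z ∉ (v ∷ x ∷ w ∷ [])
  × ¬ Edge G x y × ¬ Edge G w z
  × G' ≡ rewire G x w y z x y w z )

TriangleSwitch : ∀ {n} → Adj n → Adj n → Set
TriangleSwitch G G' = MakeMove G G' ⊎ BreakMove G G'

vecsOver : ∀ {A : Set} → List A → (m : ℕ) → List (Vec A m)
vecsOver xs zero = [ [] ]
vecsOver xs (suc m) = concatMap (λ v → map (λ x → x ∷ v) xs) (vecsOver xs m)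

allAdj : (n : ℕ) → List (Adj n)
allAdj n = vecsOver (vecsOver (true ∷ false ∷ []) n) n

allCubic : (n : ℕ) → List (Adj n)
allCubic n = filterᵇ isCubic (allAdj n)

sumℚ : List ℚ → ℚ
sumℚ = foldr _+_ 0ℚ

IsTransitionMatrix : (n : ℕ) → (Adj n → Adj n → ℚ) → Set
IsTransitionMatrix n P =
  (∀ G G' → Cubic G → Cubic G' → 0ℚ ≤ P G G')
  × (∀ G → Cubic G → sumℚ (map (P G) (allCubic n)) ≡ 1ℚ)

IsTriangleSwitchChain : (n : ℕ) → (Adj n → Adj n → ℚ) → Set
IsTriangleSwitchChain n P =
  IsTransitionMatrix n P × (∀ G G' → Cubic G → TriangleSwitch G G' → 0ℚ < P G G')

PosStep : ∀ {n} → (Adj n → Adj n → ℚ) → Adj n → Adj n → Set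
PosStep P G G' = Cubic G × Cubic G' × 0ℚ < P G G'

-- irreducible: every state reaches every state, i.e. P^t(G,G') > 0 for some t ≥ 0
Irreducible : (n : ℕ) → (Adj n → Adj n → ℚ) → Set
Irreducible n P = ∀ G G' → Cubic G → Cubic G' → Star (PosStep P) G G'

{-# OPTIONS --safe #-}
module Submission where

-- The inverse of a make move is a break move, so it suffices to bring every cubic graph into a normal form.
-- Both moves only look at the subgraph induced on at most five vertices. Hence, exploring a graph one
-- neighbour at a time, one can produce first a triangle, then a diamond or a prism, then a K₄; the only
-- obstruction is a prism on exactly 6 vertices. Three moves exchange a vertex of a K₄ with any vertex
-- outside it, so the K₄ can be placed on the first four vertices, and what remains is a smaller cubic graph.
-- Prisms on 6 vertices are joined by explicit transpositions of their labels.

open import Defs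
open import Data.Bool using (Bool; true; false; not; _∧_; _∨_; if_then_else_; _xor_)
open import Data.Bool.ListAction using (and)
open import Data.Bool.Properties using (∨-comm; ∧-comm; ¬-not; T-≡) renaming (_≟_ to _≟ᵇ_)
open import Data.Empty using (⊥)
open import Data.Fin using (Fin; zero; suc; toℕ; fromℕ<; punchIn; _↑ˡ_; _↑ʳ_)
open import Data.Fin.Patterns
open import Data.Fin.Permutation.Components using (transpose; transpose-inverse)
open import Data.Fin.Properties
  using (_≟_; all?; any?; injective⇒≤; suc-injective; 0≢1+n; toℕ-fromℕ<; toℕ-injective; toℕ<n;
         ↑ˡ-injective; ↑ʳ-injective)
open import Data.List using (List; []; _∷_; map; filter; allFin; tabulate)
open import Data.List.Membership.DecPropositional using (_∈?_)
open import Data.List.Membership.Propositional using (_∈_; _∉_)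
open import Data.List.Membership.Propositional.Properties using (∈-filter⁺; ∈-map⁺; ∈-concatMap⁺)
open import Data.List.Properties using (map-tabulate)
open import Data.List.Relation.Unary.All using ([]; _∷_)
open import Data.List.Relation.Unary.AllPairs using ([]; _∷_)
open import Data.List.Relation.Unary.Any as Any using (here; there)
open import Data.List.Relation.Unary.Unique.DecPropositional using (unique?)
open import Data.List.Relation.Unary.Unique.Propositional using (Unique)
import Data.List.Relation.Unary.Unique.Propositional.Properties as Unique
open import Data.Nat using (ℕ; zero; suc; _+_; _≤_; _<_; z≤n; s≤s; s≤s⁻¹; _≡ᵇ_; _<?_; _≤?_)
open import Data.Nat.Divisibility using (_∣_)
open import Data.Nat.ListAction using (sum)
open import Data.Nat.Properties
  using (+-assoc; +-comm; ≤-refl; ≤-trans; ≤-reflexive; <-irrefl; +-mono-≤; +-monoʳ-≤; <⇒≱; n≤1+n; 1+n≰n;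
         m≤n⇒m<n∨m≡n; ≤∧≢⇒<; ≡ᵇ⇒≡; module ≤-Reasoning)
  renaming (_≟_ to _≟ⁿ_)
open import Data.Product using (∃; ∃-syntax; _×_; _,_; proj₁; proj₂)
open import Data.Rational using (ℚ)
open import Data.Sum using (_⊎_; inj₁; inj₂)
open import Data.Unit using (⊤; tt)
open import Data.Vec as Vec using (Vec; []; _∷_; lookup; zipWith; replicate)
open import Data.Vec.Properties
  using (lookup∘tabulate; tabulate∘lookup; tabulate-cong; lookup-zipWith; lookup-replicate)
open import Function using (_∘_; id; case_of_; Equivalence)
open import Function.Definitions using (Injective)
open import Relation.Binary.Construct.Closure.ReflexiveTransitive using (Star; ε; _◅_; _◅◅_)
open import Relation.Binary.PropositionalEquality
  using (_≡_; _≢_; _≗_; refl; sym; trans; cong; cong₂; subst; subst₂; module ≡-Reasoning)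
open import Relation.Nullary using (¬_; Dec; yes; no; contradiction)
open import Relation.Nullary.Decidable using (⌊_⌋; _×-dec_; _→-dec_; ¬?; map′; toWitness)

-- Locality turns each step on an arbitrary graph into a finite check. Legality and effect of a move
-- depend only on the pairs among its vertices, so a move found in an induced subgraph can be
-- carried out in the whole graph. Degree 3 guarantees that a vertex with fewer than three known
-- neighbours has a further one, and it bounds how that vertex can attach to the known ones. A
-- strategy is thus a finite tree over small matrices, whose correctness is decidable and is settled
-- by evaluation.
--
-- The prism on 6 vertices is an obstruction because all its degrees are 3: inside it there is
-- nothing left to explore, and no further vertex exists. Nor can a cubic graph on 6 vertices
-- contain a K₄, as the other two vertices would have to form a cubic graph. A K₄ is saturated in
-- the same way, hence a whole component, which is what makes it possible to split it off.

Inj : ∀ {m n} → (Fin m → Fin n) → Set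
Inj = Injective _≡_ _≡_

true≢false : ∀ {b} → b ≡ true → b ≢ false
true≢false refl ()

⌊≟⌋-refl : ∀ {n} (i : Fin n) → ⌊ i ≟ i ⌋ ≡ true
⌊≟⌋-refl i with i ≟ i
... | yes _ = refl
... | no i≢i = contradiction refl i≢i

⌊≟⌋-≢ : ∀ {n} {i j : Fin n} → i ≢ j → ⌊ i ≟ j ⌋ ≡ false
⌊≟⌋-≢ {i = i} {j} i≢j with i ≟ j
... | yes i≡j = contradiction i≡j i≢j
... | no _ = refl

⌊≟⌋-injective : ∀ {m n} {f : Fin m → Fin n} → Inj f → ∀ i j → ⌊ f i ≟ f j ⌋ ≡ ⌊ i ≟ j ⌋
⌊≟⌋-injective {f = f} inj i j with i ≟ j
... | yes refl = ⌊≟⌋-refl (f i)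
... | no i≢j = ⌊≟⌋-≢ (i≢j ∘ inj)

-- Counting

count : ∀ {n} → (Fin n → Bool) → ℕ
count {zero} p = 0
count {suc n} p = (if p zero then 1 else 0) + count (p ∘ suc)

count-cong : ∀ {n} {p q : Fin n → Bool} → p ≗ q → count p ≡ count q
count-cong {zero} p≗q = refl
count-cong {suc n} p≗q =
  cong₂ _+_ (cong (λ b → if b then 1 else 0) (p≗q zero)) (count-cong (p≗q ∘ suc))

count-false : ∀ {n} {p : Fin n → Bool} → (∀ i → p i ≡ false) → count p ≡ 0
count-false {zero} _ = refl
count-false {suc n} none rewrite none zero = count-false (none ∘ suc)

count-true : ∀ {n} {p : Fin n → Bool} → (∀ i → p i ≡ true) → count p ≡ n
count-true {zero} _ = refl
count-true {suc n} every rewrite every zero = cong suc (count-true (every ∘ suc))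

count≤ : ∀ {n} (p : Fin n → Bool) → count p ≤ n
count≤ {zero} p = z≤n
count≤ {suc n} p with p zero
... | true = s≤s (count≤ (p ∘ suc))
... | false = ≤-trans (count≤ (p ∘ suc)) (n≤1+n n)

clear : ∀ {n} → Fin n → (Fin n → Bool) → Fin n → Bool
clear i p j = if ⌊ i ≟ j ⌋ then false else p j

clear-self : ∀ {n} (i : Fin n) p → clear i p i ≡ false
clear-self i p rewrite ⌊≟⌋-refl i = refl

clear-other : ∀ {n} {i j : Fin n} p → i ≢ j → clear i p j ≡ p j
clear-other p i≢j rewrite ⌊≟⌋-≢ i≢j = refl

-- The removal step behind both pigeonhole bounds below and behind `count-exchange`.
count-clear : ∀ {n} (i : Fin n) p → count p ≡ (if p i then 1 else 0) + count (clear i p)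
count-clear zero p = cong ((if p zero then 1 else 0) +_)
  (count-cong λ j → sym (clear-other {i = zero} {suc j} p 0≢1+n))
count-clear (suc i) p = begin
  p₀ + count (p ∘ suc)                          ≡⟨ cong (p₀ +_) (count-clear i (p ∘ suc)) ⟩
  p₀ + (pᵢ + count (clear i (p ∘ suc)))         ≡⟨ +-assoc p₀ pᵢ _ ⟨
  p₀ + pᵢ + count (clear i (p ∘ suc))           ≡⟨ cong (_+ count (clear i (p ∘ suc))) (+-comm p₀ pᵢ) ⟩
  pᵢ + p₀ + count (clear i (p ∘ suc))           ≡⟨ +-assoc pᵢ p₀ _ ⟩
  pᵢ + (p₀ + count (clear i (p ∘ suc)))         ≡⟨ cong (λ c → pᵢ + (p₀ + c)) (count-cong clear-suc) ⟩
  pᵢ + count (clear (suc i) p)                  ∎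
  where
  open ≡-Reasoning
  p₀ = if p zero then 1 else 0
  pᵢ = if p (suc i) then 1 else 0
  clear-suc : clear i (p ∘ suc) ≗ clear (suc i) p ∘ suc
  clear-suc j = cong (λ b → if b then false else p (suc j)) (sym (⌊≟⌋-injective suc-injective i j))

-- Induction on the domain: once `f zero` has been counted it can be cleared, and by injectivity the
-- other values of `f` do not notice.
count-∘-injective : ∀ {m n} {f : Fin m → Fin n} → Inj f → ∀ p → count (p ∘ f) ≤ count p
count-∘-injective {zero} _ p = z≤n
count-∘-injective {suc m} {f = f} inj p = begin
  p₀ + count (p ∘ f ∘ suc)                ≡⟨ cong (p₀ +_) (count-cong not-cleared) ⟩
  p₀ + count (clear (f zero) p ∘ f ∘ suc) ≤⟨ +-monoʳ-≤ p₀ (count-∘-injective (suc-injective ∘ inj) _) ⟩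
  p₀ + count (clear (f zero) p)           ≡⟨ count-clear (f zero) p ⟨
  count p                                 ∎
  where
  open ≤-Reasoning
  p₀ = if p (f zero) then 1 else 0
  not-cleared : ∀ i → p (f (suc i)) ≡ clear (f zero) p (f (suc i))
  not-cleared i = sym (clear-other p (0≢1+n ∘ inj))

count-mono : ∀ {n} {p q : Fin n → Bool} → (∀ i → p i ≡ true → q i ≡ true) → count p ≤ count q
count-mono {zero} _ = z≤n
count-mono {suc n} {p} {q} p⇒q = +-mono-≤ (head-≤ (p zero) (q zero) (p⇒q zero)) (count-mono (p⇒q ∘ suc))
  where
  head-≤ : ∀ b c → (b ≡ true → c ≡ true) → (if b then 1 else 0) ≤ (if c then 1 else 0)
  head-≤ true c imp rewrite imp refl = ≤-refl
  head-≤ false c imp = z≤n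

-- The converse bound, by the same clearing. Repeated values of `f` do no harm, since they can only
-- enlarge the right-hand side.
count-∘-cover : ∀ {m n} (f : Fin m → Fin n) p → (∀ j → p j ≡ true → ∃[ i ] f i ≡ j) → count p ≤ count (p ∘ f)
count-∘-cover {zero} f p cover =
  ≤-reflexive (count-false λ j → ¬-not λ pj → case proj₁ (cover j pj) of λ ())
count-∘-cover {suc m} f p cover = begin
  count p                                 ≡⟨ count-clear (f zero) p ⟩
  p₀ + count (clear (f zero) p)           ≤⟨ +-monoʳ-≤ p₀ (count-∘-cover (f ∘ suc) _ cover′) ⟩
  p₀ + count (clear (f zero) p ∘ f ∘ suc) ≤⟨ +-monoʳ-≤ p₀ (count-mono λ i → clear-true (f (suc i))) ⟩
  p₀ + count (p ∘ f ∘ suc)                ∎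
  where
  open ≤-Reasoning
  p₀ = if p (f zero) then 1 else 0
  clear-true : ∀ j → clear (f zero) p j ≡ true → p j ≡ true
  clear-true j eq with f zero ≟ j
  clear-true j () | yes _
  ... | no _ = eq
  cover′ : ∀ j → clear (f zero) p j ≡ true → ∃[ i ] f (suc i) ≡ j
  cover′ j eq with cover j (clear-true j eq)
  ... | zero , refl = contradiction (clear-self (f zero) p) (true≢false eq)
  ... | suc i , fi≡j = i , fi≡j

-- Supplies every new vertex of the proof: an unseen neighbour when `p` is a row of the graph, any
-- unseen vertex when `p` is constantly true.
count-fresh : ∀ {m n} (f : Fin m → Fin n) p → count (p ∘ f) < count p →
              ∃[ j ] p j ≡ true × (∀ i → f i ≢ j)
count-fresh f p lt with any? (λ j → p j ≟ᵇ true ×-dec all? λ i → ¬? (f i ≟ j))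
... | yes found = found
... | no none = contradiction (count-∘-cover f p cover) (<⇒≱ lt)
  where
  cover : ∀ j → p j ≡ true → ∃[ i ] f i ≡ j
  cover j pj with any? (λ i → f i ≟ j)
  ... | yes hit = hit
  ... | no miss = contradiction (j , pj , λ i eq → miss (i , eq)) none

count-exchange : ∀ {n} {p q : Fin n → Bool} (b c : Fin n) →
  p b ≡ true → p c ≡ false → q b ≡ false → q c ≡ true →
  (∀ j → j ≢ b → j ≢ c → p j ≡ q j) → count p ≡ count q
count-exchange {p = p} {q} b c pb pc qb qc same
  rewrite count-clear b p | count-clear c q | pb | qc = cong suc (count-cong cleared)
  where
  cleared : clear b p ≗ clear c q
  cleared j with b ≟ j | c ≟ j
  ... | yes _ | yes _ = refl
  ... | yes refl | no _ = sym qb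
  ... | no _ | yes refl = pc
  ... | no b≢j | no c≢j = same j (b≢j ∘ sym) (c≢j ∘ sym)

-- Cubic graphs

and-tabulate : ∀ {n} (p : Fin n → Bool) → and (map p (allFin n)) ≡ true → ∀ i → p i ≡ true
and-tabulate p eq = go p (subst (λ l → and l ≡ true) (map-tabulate id p) eq)
  where
  go : ∀ {n} (p : Fin n → Bool) → and (tabulate p) ≡ true → ∀ i → p i ≡ true
  go {suc n} p eq i with p zero in p₀
  go {suc n} p eq zero | true = p₀
  go {suc n} p eq (suc i) | true = go (p ∘ suc) eq i

tabulate-and : ∀ {n} (p : Fin n → Bool) → (∀ i → p i ≡ true) → and (map p (allFin n)) ≡ true
tabulate-and p every = trans (cong and (map-tabulate id p)) (go p every)
  where
  go : ∀ {n} (p : Fin n → Bool) → (∀ i → p i ≡ true) → and (tabulate p) ≡ true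
  go {zero} p every = refl
  go {suc n} p every rewrite every zero = go (p ∘ suc) (every ∘ suc)

sum-count : ∀ {n} (p : Fin n → Bool) → sum (map (λ j → if p j then 1 else 0) (allFin n)) ≡ count p
sum-count p = trans (cong sum (map-tabulate id λ j → if p j then 1 else 0)) (go p)
  where
  go : ∀ {n} (p : Fin n → Bool) → sum (tabulate λ j → if p j then 1 else 0) ≡ count p
  go {zero} p = refl
  go {suc n} p = cong ((if p zero then 1 else 0) +_) (go (p ∘ suc))

degree : ∀ {n} → Adj n → Fin n → ℕ
degree G i = count (entry G i)

record IsCubic {n} (G : Adj n) : Set where
  field
    symm : ∀ i j → entry G i j ≡ entry G j i
    irrefl : ∀ i → entry G i i ≡ false
    deg : ∀ i → degree G i ≡ 3

open IsCubic

cubic⇒ : ∀ {n} {G : Adj n} → Cubic G → IsCubic G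
cubic⇒ {n} {G} cubic = record
  { symm = λ i j → xor-false _ _ (and-tabulate _ (proj₁ (parts i)) j)
  ; irrefl = λ i → not-true _ (proj₁ (proj₂ (parts i)))
  ; deg = λ i → trans (sym (sum-count (entry G i)))
                      (≡ᵇ⇒≡ _ 3 (Equivalence.from T-≡ (proj₂ (proj₂ (parts i)))))
  }
  where
  ∧-true : ∀ a b → a ∧ b ≡ true → a ≡ true × b ≡ true
  ∧-true true true _ = refl , refl
  xor-false : ∀ a b → not (a xor b) ≡ true → a ≡ b
  xor-false true true _ = refl
  xor-false false false _ = refl
  not-true : ∀ a → not a ≡ true → a ≡ false
  not-true false _ = refl
  parts : ∀ i → and (map (λ j → not (entry G i j xor entry G j i)) (allFin n)) ≡ true
              × not (entry G i i) ≡ true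
              × (sum (map (λ j → if entry G i j then 1 else 0) (allFin n)) ≡ᵇ 3) ≡ true
  parts i with ∧-true _ _ (and-tabulate _ cubic i)
  ... | s , rest = s , ∧-true _ _ rest

⇒cubic : ∀ {n} {G : Adj n} → IsCubic G → Cubic G
⇒cubic {n} {G} cubic = tabulate-and _ vertex
  where
  xor-symm : ∀ i j → not (entry G i j xor entry G j i) ≡ true
  xor-symm i j rewrite symm cubic i j with entry G j i
  ... | true = refl
  ... | false = refl
  vertex : ∀ i → and (map (λ j → not (entry G i j xor entry G j i)) (allFin n))
               ∧ not (entry G i i)
               ∧ (sum (map (λ j → if entry G i j then 1 else 0) (allFin n)) ≡ᵇ 3) ≡ true
  vertex i rewrite tabulate-and (λ j → not (entry G i j xor entry G j i)) (xor-symm i)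
                 | irrefl cubic i | sum-count (entry G i) | deg cubic i = refl

tabulate² : ∀ {n} → (Fin n → Fin n → Bool) → Adj n
tabulate² F = Vec.tabulate λ i → Vec.tabulate (F i)

entry-tabulate² : ∀ {n} (F : Fin n → Fin n → Bool) i j → entry (tabulate² F) i j ≡ F i j
entry-tabulate² F i j
  rewrite lookup∘tabulate (λ i → Vec.tabulate (F i)) i = lookup∘tabulate (F i) j

adj-ext : ∀ {n} {G H : Adj n} → (∀ i j → entry G i j ≡ entry H i j) → G ≡ H
adj-ext {G = G} {H} same = begin
  G                                                    ≡⟨ tabulate²-entry G ⟨
  tabulate² (entry G)                                  ≡⟨ tabulate-cong (λ i → tabulate-cong (same i)) ⟩
  tabulate² (entry H)                                  ≡⟨ tabulate²-entry H ⟩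
  H                                                    ∎
  where
  open ≡-Reasoning
  tabulate²-entry : ∀ {n} (G : Adj n) → tabulate² (entry G) ≡ G
  tabulate²-entry G = trans (tabulate-cong λ i → tabulate∘lookup (lookup G i)) (tabulate∘lookup G)

-- Switches

sameEdge⇒ : ∀ {n} {a b i j : Fin n} → sameEdge a b i j ≡ true → (i ≡ a × j ≡ b) ⊎ (i ≡ b × j ≡ a)
sameEdge⇒ {a = a} {b} {i} {j} eq with i ≟ a | j ≟ b | i ≟ b | j ≟ a
... | yes i≡a | yes j≡b | _ | _ = inj₁ (i≡a , j≡b)
... | yes _ | no _ | yes i≡b | yes j≡a = inj₂ (i≡b , j≡a)
... | no _ | _ | yes i≡b | yes j≡a = inj₂ (i≡b , j≡a)
sameEdge⇒ () | yes _ | no _ | yes _ | no _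
sameEdge⇒ () | yes _ | no _ | no _ | _
sameEdge⇒ () | no _ | _ | yes _ | no _
sameEdge⇒ () | no _ | _ | no _ | _

sameEdge-refl : ∀ {n} (a b : Fin n) → sameEdge a b a b ≡ true
sameEdge-refl a b rewrite ⌊≟⌋-refl a | ⌊≟⌋-refl b = refl

sameEdge-∉ : ∀ {n} {a b i : Fin n} j → i ≢ a → i ≢ b → sameEdge a b i j ≡ false
sameEdge-∉ j i≢a i≢b rewrite ⌊≟⌋-≢ i≢a | ⌊≟⌋-≢ i≢b = refl

sameEdge-≢ : ∀ {n} {a b j : Fin n} → a ≢ b → j ≢ b → sameEdge a b a j ≡ false
sameEdge-≢ {a = a} a≢b j≢b rewrite ⌊≟⌋-refl a | ⌊≟⌋-≢ a≢b | ⌊≟⌋-≢ j≢b = refl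

sameEdge-swap : ∀ {n} (a b i j : Fin n) → sameEdge a b i j ≡ sameEdge b a i j
sameEdge-swap a b i j = ∨-comm (⌊ i ≟ a ⌋ ∧ ⌊ j ≟ b ⌋) _

sameEdge-sym : ∀ {n} (a b i j : Fin n) → sameEdge a b i j ≡ sameEdge a b j i
sameEdge-sym a b i j rewrite ∧-comm ⌊ i ≟ a ⌋ ⌊ j ≟ b ⌋ | ∧-comm ⌊ i ≟ b ⌋ ⌊ j ≟ a ⌋ =
  ∨-comm (⌊ j ≟ b ⌋ ∧ ⌊ i ≟ a ⌋) _

sameEdge-injective : ∀ {m n} {f : Fin m → Fin n} → Inj f →
                     ∀ a b i j → sameEdge (f a) (f b) (f i) (f j) ≡ sameEdge a b i j
sameEdge-injective inj a b i j
  rewrite ⌊≟⌋-injective inj i a | ⌊≟⌋-injective inj i b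
        | ⌊≟⌋-injective inj j a | ⌊≟⌋-injective inj j b = refl

-- Both kinds of triangle switch are of this shape: ab and cd are replaced by ac and bd.
switch : ∀ {n} → (a b c d : Fin n) → Adj n → Adj n
switch a b c d G = rewire G a b c d a c b d

entry-switch : ∀ {n} (a b c d : Fin n) G i j → entry (switch a b c d G) i j ≡
  (if sameEdge a c i j ∨ sameEdge b d i j then true
   else if sameEdge a b i j ∨ sameEdge c d i j then false
   else entry G i j)
entry-switch a b c d G = entry-tabulate² _

-- This and `switch-flip` are symmetries of the alternating 4-cycle of removed and added edges.
-- Together they act transitively on its corners, so facts need a direct proof at `a` only.
switch-swap : ∀ {n} (a b c d : Fin n) G → switch a b c d G ≡ switch b a d c G
switch-swap a b c d G = adj-ext λ i j → begin
  entry (switch a b c d G) i j ≡⟨ entry-switch a b c d G i j ⟩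
  (if sameEdge a c i j ∨ sameEdge b d i j then true
   else if sameEdge a b i j ∨ sameEdge c d i j then false else entry G i j)
    ≡⟨ cong₂ (λ p q → if p then true else if q then false else entry G i j)
         (∨-comm (sameEdge a c i j) _)
         (cong₂ _∨_ (sameEdge-swap a b i j) (sameEdge-swap c d i j)) ⟩
  (if sameEdge b d i j ∨ sameEdge a c i j then true
   else if sameEdge b a i j ∨ sameEdge d c i j then false else entry G i j)
    ≡⟨ entry-switch b a d c G i j ⟨
  entry (switch b a d c G) i j ∎
  where open ≡-Reasoning

switch-flip : ∀ {n} (a b c d : Fin n) G → switch a b c d G ≡ switch c d a b G
switch-flip a b c d G = adj-ext λ i j → begin
  entry (switch a b c d G) i j ≡⟨ entry-switch a b c d G i j ⟩
  (if sameEdge a c i j ∨ sameEdge b d i j then true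
   else if sameEdge a b i j ∨ sameEdge c d i j then false else entry G i j)
    ≡⟨ cong₂ (λ p q → if p then true else if q then false else entry G i j)
         (cong₂ _∨_ (sameEdge-swap a c i j) (sameEdge-swap b d i j))
         (∨-comm (sameEdge a b i j) _) ⟩
  (if sameEdge c a i j ∨ sameEdge d b i j then true
   else if sameEdge c d i j ∨ sameEdge a b i j then false else entry G i j)
    ≡⟨ entry-switch c d a b G i j ⟨
  entry (switch c d a b G) i j ∎
  where open ≡-Reasoning

record Switchable {n} (a b c d : Fin n) (G : Adj n) : Set where
  field
    a≢b : a ≢ b
    a≢c : a ≢ c
    a≢d : a ≢ d
    b≢c : b ≢ c
    b≢d : b ≢ d
    c≢d : c ≢ d
    ab : Edge G a b
    cd : Edge G c d
    ¬ac : ¬ Edge G a c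
    ¬bd : ¬ Edge G b d

  added : Edge (switch a b c d G) a c
  added rewrite entry-switch a b c d G a c | sameEdge-refl a c = refl

  removed : entry (switch a b c d G) a b ≡ false
  removed rewrite entry-switch a b c d G a b
                | sameEdge-≢ a≢c b≢c | sameEdge-∉ b a≢b a≢d | sameEdge-refl a b = refl

  kept : ∀ j → j ≢ b → j ≢ c → entry G a j ≡ entry (switch a b c d G) a j
  kept j j≢b j≢c rewrite entry-switch a b c d G a j
    | sameEdge-≢ a≢c j≢c | sameEdge-∉ j a≢b a≢d | sameEdge-≢ a≢b j≢b | sameEdge-∉ j a≢c a≢d = refl

  degree-kept : degree G a ≡ degree (switch a b c d G) a
  degree-kept = count-exchange b c ab (¬-not ¬ac) removed added kept

  away : ∀ {i} → i ≢ a → i ≢ b → i ≢ c → i ≢ d → ∀ j → entry (switch a b c d G) i j ≡ entry G i j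
  away {i} i≢a i≢b i≢c i≢d j rewrite entry-switch a b c d G i j
    | sameEdge-∉ j i≢a i≢c | sameEdge-∉ j i≢b i≢d | sameEdge-∉ j i≢a i≢b | sameEdge-∉ j i≢c i≢d = refl

module _ {n} {a b c d : Fin n} {G : Adj n} (cubic : IsCubic G) (s : Switchable a b c d G) where
  open Switchable s

  swapped : Switchable b a d c G
  swapped = record
    { a≢b = a≢b ∘ sym ; a≢c = b≢d ; a≢d = b≢c ; b≢c = a≢d ; b≢d = a≢c ; c≢d = c≢d ∘ sym
    ; ab = trans (symm cubic b a) ab ; cd = trans (symm cubic d c) cd ; ¬ac = ¬bd ; ¬bd = ¬ac }

  flipped : Switchable c d a b G
  flipped = record
    { a≢b = c≢d ; a≢c = a≢c ∘ sym ; a≢d = b≢c ∘ sym ; b≢c = a≢d ∘ sym ; b≢d = b≢d ∘ sym ; c≢d = a≢b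
    ; ab = cd ; cd = ab ; ¬ac = ¬ac ∘ trans (symm cubic a c) ; ¬bd = ¬bd ∘ trans (symm cubic b d) }

module _ {n} {a b c d : Fin n} {G : Adj n} (cubic : IsCubic G) (s : Switchable a b c d G) where
  open Switchable s

  switch-added : Edge (switch a b c d G) b d
  switch-added rewrite switch-swap a b c d G = Switchable.added (swapped cubic s)

  switch-removed : entry (switch a b c d G) c d ≡ false
  switch-removed rewrite switch-flip a b c d G = Switchable.removed (flipped cubic s)

  switch-sym : ∀ i j → entry (switch a b c d G) i j ≡ entry (switch a b c d G) j i
  switch-sym i j
    rewrite entry-switch a b c d G i j | entry-switch a b c d G j i
          | sameEdge-sym a c i j | sameEdge-sym b d i j
          | sameEdge-sym a b i j | sameEdge-sym c d i j | symm cubic i j = refl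

  loopless : ∀ i {x y : Fin n} → x ≢ y → sameEdge x y i i ≡ false
  loopless i {x} {y} x≢y with sameEdge x y i i in eq
  ... | false = refl
  ... | true with sameEdge⇒ {a = x} {y} {i} {i} eq
  ...   | inj₁ (refl , i≡y) = contradiction i≡y x≢y
  ...   | inj₂ (refl , i≡x) = contradiction (sym i≡x) x≢y

  switch-irrefl : ∀ i → entry (switch a b c d G) i i ≡ false
  switch-irrefl i
    rewrite entry-switch a b c d G i i | loopless i a≢c | loopless i b≢d
    with sameEdge a b i i ∨ sameEdge c d i i
  ... | true = refl
  ... | false = irrefl cubic i

  switch-degree : ∀ i → degree (switch a b c d G) i ≡ degree G i
  switch-degree i with i ≟ a | i ≟ b | i ≟ c | i ≟ d
  ... | yes refl | _ | _ | _ = sym degree-kept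
  ... | _ | yes refl | _ | _ rewrite switch-swap a b c d G =
    sym (Switchable.degree-kept (swapped cubic s))
  ... | _ | _ | yes refl | _ rewrite switch-flip a b c d G =
    sym (Switchable.degree-kept (flipped cubic s))
  ... | _ | _ | _ | yes refl rewrite switch-flip a b c d G | switch-swap c d a b G =
    sym (Switchable.degree-kept (swapped cubic (flipped cubic s)))
  ... | no i≢a | no i≢b | no i≢c | no i≢d = count-cong (away i≢a i≢b i≢c i≢d)

  switch-cubic : IsCubic (switch a b c d G)
  switch-cubic = record
    { symm = switch-sym
    ; irrefl = switch-irrefl
    ; deg = λ i → trans (switch-degree i) (deg cubic i)
    }

  switch-involutive : switch a c b d (switch a b c d G) ≡ G
  switch-involutive = adj-ext restored
    where
    edge : ∀ {x y} → Edge G x y → ∀ {i j} → sameEdge x y i j ≡ true → entry G i j ≡ true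
    edge {x} {y} xy {i} {j} eq with sameEdge⇒ {a = x} {y} {i} {j} eq
    ... | inj₁ (refl , refl) = xy
    ... | inj₂ (refl , refl) = trans (symm cubic i j) xy
    non-edge : ∀ {x y} → ¬ Edge G x y → ∀ {i j} → sameEdge x y i j ≡ true → entry G i j ≡ false
    non-edge {x} {y} ¬xy {i} {j} eq with sameEdge⇒ {a = x} {y} {i} {j} eq
    ... | inj₁ (refl , refl) = ¬-not ¬xy
    ... | inj₂ (refl , refl) = ¬-not (¬xy ∘ trans (symm cubic j i))
    restored : ∀ i j → entry (switch a c b d (switch a b c d G)) i j ≡ entry G i j
    restored i j
      rewrite entry-switch a c b d (switch a b c d G) i j | entry-switch a b c d G i j
      with sameEdge a b i j in e₁ | sameEdge c d i j in e₂ | sameEdge a c i j in e₃ | sameEdge b d i j in e₄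
    ... | true | _ | _ | _ = sym (edge ab e₁)
    ... | false | true | _ | _ = sym (edge cd e₂)
    ... | false | false | true | _ = sym (non-edge ¬ac e₃)
    ... | false | false | false | true = sym (non-edge ¬bd e₄)
    ... | false | false | false | false = refl

-- Triangle switches

-- Moves are data so that the same move can be read in a small known subgraph and, through
-- `relabel`, in the graph containing it.
data Move (n : ℕ) : Set where
  make break : (_ _ _ _ _ : Fin n) → Move n

Legal : ∀ {n} → Move n → Adj n → Set
Legal (make y x v w z) G = Unique (y ∷ x ∷ v ∷ w ∷ z ∷ [])
  × Edge G y x × Edge G x v × Edge G v w × Edge G w z × ¬ Edge G x w × ¬ Edge G y z
Legal (break v x w y z) G = Unique (v ∷ x ∷ w ∷ [])
  × Edge G v x × Edge G x w × Edge G w v × Edge G y z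
  × y ∉ (v ∷ x ∷ w ∷ []) × z ∉ (v ∷ x ∷ w ∷ []) × ¬ Edge G x y × ¬ Edge G w z

after : ∀ {n} → Move n → Adj n → Adj n
after (make y x v w z) = switch x y w z
after (break v x w y z) = switch x w y z

reverse : ∀ {n} → Move n → Move n
reverse (make y x v w z) = break v x w y z
reverse (break v x w y z) = make y x v w z

relabel : ∀ {m n} → (Fin m → Fin n) → Move m → Move n
relabel f (make y x v w z) = make (f y) (f x) (f v) (f w) (f z)
relabel f (break v x w y z) = break (f v) (f x) (f w) (f y) (f z)

triangleSwitch : ∀ {n} (m : Move n) {G} → Legal m G → TriangleSwitch G (after m G)
triangleSwitch (make y x v w z) (u , yx , xv , vw , wz , ¬xw , ¬yz) =
  inj₁ (y , x , v , w , z , u , yx , xv , vw , wz , ¬xw , ¬yz , refl)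
triangleSwitch (break v x w y z) (u , vx , xw , wv , yz , y∉ , z∉ , ¬xy , ¬wz) =
  inj₂ (v , x , w , y , z , u , vx , xw , wv , yz , y∉ , z∉ , ¬xy , ¬wz , refl)

fromTriangleSwitch : ∀ {n} {G G′ : Adj n} → TriangleSwitch G G′ →
                     ∃[ m ] Legal m G × after m G ≡ G′
fromTriangleSwitch (inj₁ (y , x , v , w , z , u , yx , xv , vw , wz , ¬xw , ¬yz , refl)) =
  make y x v w z , (u , yx , xv , vw , wz , ¬xw , ¬yz) , refl
fromTriangleSwitch (inj₂ (v , x , w , y , z , u , vx , xw , wv , yz , y∉ , z∉ , ¬xy , ¬wz , refl)) =
  break v x w y z , (u , vx , xw , wv , yz , y∉ , z∉ , ¬xy , ¬wz) , refl

edge⇒≢ : ∀ {n} {G : Adj n} {i j} → IsCubic G → Edge G i j → i ≢ j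
edge⇒≢ cubic ij refl = true≢false ij (irrefl cubic _)

make-switchable : ∀ {n} {y x v w z : Fin n} {G} → Legal (make y x v w z) G → IsCubic G →
                  Switchable x y w z G
make-switchable
  (((y≢x ∷ _ ∷ y≢w ∷ y≢z ∷ []) ∷ (_ ∷ x≢w ∷ x≢z ∷ []) ∷ _ ∷ (w≢z ∷ []) ∷ [] ∷ [])
  , yx , xv , vw , wz , ¬xw , ¬yz) cubic = record
  { a≢b = y≢x ∘ sym ; a≢c = x≢w ; a≢d = x≢z ; b≢c = y≢w ; b≢d = y≢z ; c≢d = w≢z
  ; ab = trans (symm cubic _ _) yx ; cd = wz ; ¬ac = ¬xw ; ¬bd = ¬yz }

break-switchable : ∀ {n} {v x w y z : Fin n} {G} → Legal (break v x w y z) G → IsCubic G →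
                   Switchable x w y z G
break-switchable
  (((_ ∷ _ ∷ []) ∷ (x≢w ∷ []) ∷ [] ∷ []) , vx , xw , wv , yz , y∉ , z∉ , ¬xy , ¬wz) cubic = record
  { a≢b = x≢w
  ; a≢c = λ { refl → y∉ (there (here refl)) }
  ; a≢d = λ { refl → z∉ (there (here refl)) }
  ; b≢c = λ { refl → y∉ (there (there (here refl))) }
  ; b≢d = λ { refl → z∉ (there (there (here refl))) }
  ; c≢d = edge⇒≢ cubic yz
  ; ab = xw ; cd = yz ; ¬ac = ¬xy ; ¬bd = ¬wz }

after-cubic : ∀ {n} (m : Move n) {G} → Legal m G → IsCubic G → IsCubic (after m G)
after-cubic (make _ _ _ _ _) legal cubic = switch-cubic cubic (make-switchable legal cubic)
after-cubic (break _ _ _ _ _) legal cubic = switch-cubic cubic (break-switchable legal cubic)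

after-reverse : ∀ {n} (m : Move n) {G} → Legal m G → IsCubic G → after (reverse m) (after m G) ≡ G
after-reverse (make _ _ _ _ _) legal cubic = switch-involutive cubic (make-switchable legal cubic)
after-reverse (break _ _ _ _ _) legal cubic = switch-involutive cubic (break-switchable legal cubic)

-- The apex `v` is not among the four rewired vertices, so its two edges survive; the other
-- conditions are the added and removed edges of the switch.
reverse-legal : ∀ {n} (m : Move n) {G} → Legal m G → IsCubic G → Legal (reverse m) (after m G)
reverse-legal (make y x v w z) {G}
  legal@(((y≢x ∷ y≢v ∷ y≢w ∷ y≢z ∷ []) ∷ (x≢v ∷ x≢w ∷ x≢z ∷ []) ∷ (v≢w ∷ v≢z ∷ []) ∷ (w≢z ∷ []) ∷ [] ∷ [])
  , yx , xv , vw , wz , ¬xw , ¬yz) cubic =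
    ((x≢v ∘ sym ∷ v≢w ∷ []) ∷ (x≢w ∷ []) ∷ [] ∷ [])
  , trans (near x) (trans (symm cubic v x) xv)
  , added
  , trans (switch-sym cubic s w v) (trans (near w) vw)
  , switch-added cubic s
  , (λ { (here y≡v) → y≢v y≡v ; (there (here y≡x)) → y≢x y≡x ; (there (there (here y≡w))) → y≢w y≡w })
  , (λ { (here z≡v) → v≢z (sym z≡v) ; (there (here z≡x)) → x≢z (sym z≡x)
       ; (there (there (here z≡w))) → w≢z (sym z≡w) })
  , (λ xy → true≢false xy removed)
  , (λ wz → true≢false wz (switch-removed cubic s))
  where
  s = make-switchable legal cubic
  open Switchable s using (added; removed; away)
  near = away {v} (x≢v ∘ sym) (y≢v ∘ sym) v≢w v≢z
reverse-legal (break v x w y z) {G}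
  legal@(((v≢x ∷ v≢w ∷ []) ∷ (x≢w ∷ []) ∷ [] ∷ []) , vx , xw , wv , yz , y∉ , z∉ , ¬xy , ¬wz) cubic =
    ((a≢c ∘ sym ∷ y∉ ∘ here ∷ b≢c ∘ sym ∷ c≢d ∷ []) ∷ (v≢x ∘ sym ∷ a≢b ∷ a≢d ∷ [])
      ∷ (v≢w ∷ z∉ ∘ here ∘ sym ∷ []) ∷ (b≢d ∷ []) ∷ [] ∷ [])
  , trans (switch-sym cubic s y x) added
  , trans (switch-sym cubic s x v) (trans (near x) vx)
  , trans (near w) (trans (symm cubic v w) wv)
  , switch-added cubic s
  , (λ xw → true≢false xw removed)
  , (λ yz → true≢false yz (switch-removed cubic s))
  where
  s = break-switchable legal cubic
  open Switchable s using (a≢b; a≢c; a≢d; b≢c; b≢d; c≢d; added; removed; away)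
  near = away {v} v≢x v≢w (y∉ ∘ here ∘ sym) (z∉ ∘ here ∘ sym)

-- Paths of triangle switches

infix 4 _⇝_
_⇝_ : ∀ {n} → Adj n → Adj n → Set
_⇝_ = Star TriangleSwitch

⇝-cubic : ∀ {n} {G G′ : Adj n} → IsCubic G → G ⇝ G′ → IsCubic G′
⇝-cubic cubic ε = cubic
⇝-cubic {G = G} cubic (_◅_ {j = G₁} t ts) with fromTriangleSwitch {G = G} {G₁} t
... | m , legal , refl = ⇝-cubic (after-cubic m legal cubic) ts

⇝-sym : ∀ {n} {G G′ : Adj n} → IsCubic G → G ⇝ G′ → G′ ⇝ G
⇝-sym cubic ε = ε
⇝-sym {G = G} cubic (_◅_ {j = G₁} t ts) with fromTriangleSwitch {G = G} {G₁} t
... | m , legal , refl =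
  ⇝-sym (after-cubic m legal cubic) ts
    ◅◅ subst (TriangleSwitch (after m G)) (after-reverse m legal cubic)
         (triangleSwitch (reverse m) (reverse-legal m legal cubic)) ◅ ε

-- Induced subgraphs

Induced : ∀ {k n} → Adj n → (Fin k → Fin n) → Adj k → Set
Induced G f H = ∀ i j → entry G (f i) (f j) ≡ entry H i j

-- Legality speaks only of distinctness, edges and non-edges among the vertices named, all of which
-- an injective induced copy preserves in both directions.
relabel-legal : ∀ {k n} (m : Move k) {G : Adj n} {f} {H} → Inj f → Induced G f H →
                Legal m H → Legal (relabel f m) G
relabel-legal (make _ _ _ _ _) inj ind (u , yx , xv , vw , wz , ¬xw , ¬yz) =
    Unique.map⁺ inj u
  , trans (ind _ _) yx , trans (ind _ _) xv , trans (ind _ _) vw , trans (ind _ _) wz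
  , ¬xw ∘ trans (sym (ind _ _)) , ¬yz ∘ trans (sym (ind _ _))
relabel-legal (break v x w _ _) {f = f} inj ind (u , vx , xw , wv , yz , y∉ , z∉ , ¬xy , ¬wz) =
    Unique.map⁺ inj u
  , trans (ind _ _) vx , trans (ind _ _) xw , trans (ind _ _) wv , trans (ind _ _) yz
  , y∉ ∘ ∈-map⁻¹ , z∉ ∘ ∈-map⁻¹
  , ¬xy ∘ trans (sym (ind _ _)) , ¬wz ∘ trans (sym (ind _ _))
  where
  ∈-map⁻¹ : ∀ {i} → f i ∈ (f v ∷ f x ∷ f w ∷ []) → i ∈ (v ∷ x ∷ w ∷ [])
  ∈-map⁻¹ (here eq) = here (inj eq)
  ∈-map⁻¹ (there (here eq)) = there (here (inj eq))
  ∈-map⁻¹ (there (there (here eq))) = there (there (here (inj eq)))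

switch-induced : ∀ {k n} (a b c d : Fin k) {G : Adj n} {f} {H} → Inj f → Induced G f H →
                 Induced (switch (f a) (f b) (f c) (f d) G) f (switch a b c d H)
switch-induced a b c d {G} {f} {H} inj ind i j
  rewrite entry-switch (f a) (f b) (f c) (f d) G (f i) (f j) | entry-switch a b c d H i j
        | sameEdge-injective inj a c i j | sameEdge-injective inj b d i j
        | sameEdge-injective inj a b i j | sameEdge-injective inj c d i j | ind i j = refl

after-induced : ∀ {k n} (m : Move k) {G : Adj n} {f} {H} → Inj f → Induced G f H →
                Induced (after (relabel f m) G) f (after m H)
after-induced (make y x v w z) {G} {f} {H} = switch-induced x y w z {G} {f} {H}
after-induced (break v x w y z) {G} {f} {H} = switch-induced x w y z {G} {f} {H}

after-away : ∀ {k n} (m : Move k) {G : Adj n} {f : Fin k → Fin n} {i} → (∀ a → i ≢ f a) →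
             ∀ j → entry (after (relabel f m) G) i j ≡ entry G i j
after-away {k} m {G} {f} {i} i∉f j = go m
  where
  go : ∀ m → entry (after (relabel f m) G) i j ≡ entry G i j
  quad : ∀ a b c d → entry (switch (f a) (f b) (f c) (f d) G) i j ≡ entry G i j
  quad a b c d
    rewrite entry-switch (f a) (f b) (f c) (f d) G i j
          | sameEdge-∉ {a = f a} {f c} j (i∉f a) (i∉f c) | sameEdge-∉ {a = f b} {f d} j (i∉f b) (i∉f d)
          | sameEdge-∉ {a = f a} {f b} j (i∉f a) (i∉f b) | sameEdge-∉ {a = f c} {f d} j (i∉f c) (i∉f d) = refl
  go (make y x v w z) = quad x y w z
  go (break v x w y z) = quad x w y z

restrict : ∀ {k n} → Adj n → (Fin k → Fin n) → Adj k
restrict G f = tabulate² λ i j → entry G (f i) (f j)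

restrict-induced : ∀ {k n} (G : Adj n) (f : Fin k → Fin n) → Induced G f (restrict G f)
restrict-induced G f i j = sym (entry-tabulate² (λ i j → entry G (f i) (f j)) i j)

infixr 5 _∷ᶠ_
_∷ᶠ_ : ∀ {k n} → Fin n → (Fin k → Fin n) → Fin (suc k) → Fin n
(u ∷ᶠ f) zero = u
(u ∷ᶠ f) (suc i) = f i

∷ᶠ-injective : ∀ {k n} {u} {f : Fin k → Fin n} → (∀ i → f i ≢ u) → Inj f → Inj (u ∷ᶠ f)
∷ᶠ-injective u∉ inj {zero} {zero} _ = refl
∷ᶠ-injective u∉ inj {zero} {suc j} eq = contradiction (sym eq) (u∉ j)
∷ᶠ-injective u∉ inj {suc i} {zero} eq = contradiction eq (u∉ i)
∷ᶠ-injective u∉ inj {suc i} {suc j} eq = cong suc (inj eq)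

-- A neighbour outside the copy would be a fourth one for `f a`. This is why a K₄ or a prism has no
-- edges leaving it.
saturated : ∀ {k n} {G : Adj n} {f : Fin k → Fin n} {H} → IsCubic G → Inj f → Induced G f H →
            ∀ a → degree H a ≡ 3 → ∀ u → (∀ i → f i ≢ u) → entry G (f a) u ≡ false
saturated {G = G} {f} {H} cubic inj ind a full u u∉ = ¬-not λ edge → <⇒≱ (too-many edge) ≤-refl
  where
  open ≤-Reasoning
  too-many : Edge G (f a) u → 3 < 3
  too-many edge = begin-strict
    3                                ≡⟨ full ⟨
    degree H a                       <⟨ s≤s ≤-refl ⟩
    suc (degree H a)                 ≡⟨ cong₂ (λ b c → (if b then 1 else 0) + c) edge (count-cong (ind a)) ⟨
    count (entry G (f a) ∘ (u ∷ᶠ f)) ≤⟨ count-∘-injective (∷ᶠ-injective u∉ inj) (entry G (f a)) ⟩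
    degree G (f a)                   ≡⟨ deg cubic (f a) ⟩
    3                                ∎

extend : ∀ {k} → Vec Bool k → Adj k → Adj (suc k)
extend r H = (false ∷ r) ∷ zipWith _∷_ r H

extend-induced : ∀ {k n} {G : Adj n} {f : Fin k → Fin n} {H} r u → IsCubic G → Induced G f H →
                 (∀ i → entry G u (f i) ≡ lookup r i) → Induced G (u ∷ᶠ f) (extend r H)
extend-induced r u cubic ind row zero zero = irrefl cubic u
extend-induced r u cubic ind row zero (suc j) = row j
extend-induced {f = f} {H} r u cubic ind row (suc i) zero
  rewrite lookup-zipWith Vec._∷_ i r H = trans (symm cubic (f i) u) (row i)
extend-induced {H = H} r u cubic ind row (suc i) (suc j)
  rewrite lookup-zipWith Vec._∷_ i r H = ind i j

-- Search plans

∈-vecsOver : ∀ {A : Set} {xs : List A} → (∀ x → x ∈ xs) → ∀ {k} (v : Vec A k) → v ∈ vecsOver xs k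
∈-vecsOver every [] = here refl
∈-vecsOver {xs = xs} every (x ∷ v) =
  ∈-concatMap⁺ (λ v → map (Vec._∷ v) xs)
    (Any.map (λ { refl → ∈-map⁺ (Vec._∷ v) (every x) }) (∈-vecsOver every v))

Subcubic : ∀ {n} → Adj n → Set
Subcubic H = ∀ i → degree H i ≤ 3

-- The possible adjacencies between the known vertices and a further neighbour of a.
rows : ∀ {k} → Adj k → Fin k → List (Vec Bool k)
rows {k} H a = filter (λ r → (lookup r a ≟ᵇ true) ×-dec all? λ i → degree (extend r H) i ≤? 3)
                      -- This enumeration fixes the branch order in all plans: coordinate 0 varies
                      -- fastest, with `true` before `false`.
                      (vecsOver (true ∷ false ∷ []) k)

∈-rows : ∀ {k} (H : Adj k) a r → lookup r a ≡ true → Subcubic (extend r H) → r ∈ rows H a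
∈-rows H a r ra sub =
  ∈-filter⁺ _ (∈-vecsOver (λ { true → here refl ; false → there (here refl) }) r) (ra , sub)

induced-subcubic : ∀ {k n} {G : Adj n} {f : Fin k → Fin n} {H} →
  IsCubic G → Inj f → Induced G f H → Subcubic H
induced-subcubic {G = G} {f} {H} cubic inj ind i = begin
  degree H i                ≡⟨ count-cong (ind i) ⟨
  count (entry G (f i) ∘ f) ≤⟨ count-∘-injective inj (entry G (f i)) ⟩
  degree G (f i)            ≡⟨ deg cubic (f i) ⟩
  3                         ∎
  where open ≤-Reasoning

-- Fewer than three neighbours of `f a` are known, so `count-fresh` yields another. Its adjacencies
-- to all known vertices form `r`, which passes the degree filter because the enlarged graph is
-- again induced in a cubic one.
new-neighbour : ∀ {k n} {G : Adj n} {f : Fin k → Fin n} {H} → IsCubic G → Inj f → Induced G f H →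
  ∀ a → degree H a < 3 →
  ∃[ u ] ∃[ r ] Inj (u ∷ᶠ f) × r ∈ rows H a × Induced G (u ∷ᶠ f) (extend r H)
new-neighbour {G = G} {f} {H} cubic inj ind a low
  with count-fresh f (entry G (f a)) (begin-strict
         count (entry G (f a) ∘ f) ≡⟨ count-cong (ind a) ⟩
         degree H a                <⟨ low ⟩
         3                         ≡⟨ deg cubic (f a) ⟨
         degree G (f a)            ∎)
  where open ≤-Reasoning
... | u , au , u∉ = u , r , inj′ , ∈-rows H a r ra (induced-subcubic {H = extend r H} cubic inj′ ind′) , ind′
  where
  r = Vec.tabulate (entry G u ∘ f)
  row : ∀ i → entry G u (f i) ≡ lookup r i
  row i = sym (lookup∘tabulate (entry G u ∘ f) i)
  ra : lookup r a ≡ true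
  ra = trans (sym (row a)) (trans (symm cubic u (f a)) au)
  inj′ : Inj (u ∷ᶠ f)
  inj′ = ∷ᶠ-injective u∉ inj
  ind′ : Induced G (u ∷ᶠ f) (extend r H)
  ind′ = extend-induced r u cubic ind row

-- A proof tree for the claim that every cubic graph containing a given induced subgraph can be
-- brought into a given form. New vertices get index 0, and the branches of explore follow rows.
infixr 6 _then_
data Plan (Leaf : ℕ → Set) : ℕ → Set where
  stop : ∀ {k} → Leaf k → Plan Leaf k
  _then_ : ∀ {k} → Move k → Plan Leaf k → Plan Leaf k
  explore : ∀ {k} → Fin k → List (Plan Leaf (suc k)) → Plan Leaf k

legal? : ∀ {n} (m : Move n) G → Dec (Legal m G)
legal? (make y x v w z) G =
  unique? _≟_ (y ∷ x ∷ v ∷ w ∷ z ∷ []) ×-dec (_ ≟ᵇ true) ×-dec (_ ≟ᵇ true) ×-dec (_ ≟ᵇ true)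
    ×-dec (_ ≟ᵇ true) ×-dec ¬? (_ ≟ᵇ true) ×-dec ¬? (_ ≟ᵇ true)
legal? (break v x w y z) G =
  unique? _≟_ (v ∷ x ∷ w ∷ []) ×-dec (_ ≟ᵇ true) ×-dec (_ ≟ᵇ true) ×-dec (_ ≟ᵇ true)
    ×-dec (_ ≟ᵇ true) ×-dec ¬? (_∈?_ _≟_ y (v ∷ x ∷ w ∷ [])) ×-dec ¬? (_∈?_ _≟_ z (v ∷ x ∷ w ∷ []))
    ×-dec ¬? (_ ≟ᵇ true) ×-dec ¬? (_ ≟ᵇ true)

-- The start of a plan has m vertices; the function Fin m → Fin k locates them among those known so far.
record Target (m : ℕ) : Set₁ where
  field
    Leaf : ℕ → Set
    Hit : ∀ {k} → Leaf k → Adj k → (Fin m → Fin k) → Set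
    hit? : ∀ {k} (l : Leaf k) H s → Dec (Hit l H s)
    Goal : ∀ {n} → Adj n → (Fin m → Fin n) → Set
    hit⇒goal : ∀ {k n} {G : Adj n} {f : Fin k → Fin n} {H : Adj k} → Inj f → Induced G f H →
               ∀ l s → Hit l H s → Goal G (f ∘ s)

Reach : ∀ {n} → Adj n → (Adj n → Set) → Set
Reach G Q = ∃[ G′ ] G ⇝ G′ × Q G′

stay : ∀ {n} {G : Adj n} {Q} → Q G → Reach G Q
stay q = _ , ε , q

continue : ∀ {n} {G : Adj n} {Q R} → IsCubic G → Reach G Q →
           (∀ {G′} → IsCubic G′ → Q G′ → Reach G′ R) → Reach G R
continue cubic (G₁ , path₁ , q) next with next (⇝-cubic cubic path₁) q
... | G₂ , path₂ , r = G₂ , path₁ ◅◅ path₂ , r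

module Search {m} (target : Target m) where
  open Target target

  mutual
    Valid : ∀ {k} → Plan Leaf k → Adj k → (Fin m → Fin k) → Set
    Valid (stop l) H s = Hit l H s
    Valid (t then p) H s = Legal t H × Valid p (after t H) s
    Valid (explore a ps) H s = degree H a < 3 × ValidAll ps (rows H a) H s

    -- Plans and rows are matched by position. A row without a plan makes the tree invalid; a
    -- surplus plan is ignored. The shift of `s` by `suc` makes room for the new vertex at index 0.
    ValidAll : ∀ {k} → List (Plan Leaf (suc k)) → List (Vec Bool k) → Adj k → (Fin m → Fin k) → Set
    ValidAll _ [] H s = ⊤
    ValidAll [] (_ ∷ _) H s = ⊥
    ValidAll (p ∷ ps) (r ∷ rs) H s = Valid p (extend r H) (suc ∘ s) × ValidAll ps rs H s

  mutual
    valid? : ∀ {k} (p : Plan Leaf k) H s → Dec (Valid p H s)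
    valid? (stop l) H s = hit? l H s
    valid? (t then p) H s = legal? t H ×-dec valid? p (after t H) s
    valid? (explore a ps) H s = (degree H a <? 3) ×-dec validAll? ps (rows H a) H s

    validAll? : ∀ {k} (ps : List (Plan Leaf (suc k))) rs H s → Dec (ValidAll ps rs H s)
    validAll? _ [] H s = yes tt
    validAll? [] (_ ∷ _) H s = no λ ()
    validAll? (p ∷ ps) (r ∷ rs) H s = valid? p (extend r H) (suc ∘ s) ×-dec validAll? ps rs H s

  mutual
    -- Soundness. The invariant is that `H` is exactly the subgraph of `G` induced on the known
    -- vertices: a move changes both in parallel, and an exploration follows the branch of the row
    -- that really occurs.
    run : ∀ {k n} (p : Plan Leaf k) {G : Adj n} {f : Fin k → Fin n} {H} {s} → Valid p H s →
          IsCubic G → Inj f → Induced G f H → Reach G λ G′ → Goal G′ (f ∘ s)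
    run (stop l) {G} {f} {H} {s} hit cubic inj ind = G , ε , hit⇒goal {G = G} {f} {H} inj ind l s hit
    run (t then p) {G} {f} {H} (legal , valid) cubic inj ind
      = let legal′ = relabel-legal t {G} {f} {H} inj ind legal
            G′ , path , goal = run p valid (after-cubic (relabel f t) legal′ cubic) inj
                                 (after-induced t {G} {f} {H} inj ind)
        in G′ , triangleSwitch (relabel f t) legal′ ◅ path , goal
    run (explore a ps) {G} {f} {H} (low , valid) cubic inj ind
      with new-neighbour {G = G} {f} {H} cubic inj ind a low
    ... | u , r , inj′ , r∈ , ind′ = runAll ps r∈ valid cubic inj′ ind′

    runAll : ∀ {k n} (ps : List (Plan Leaf (suc k))) {G : Adj n} {u} {f : Fin k → Fin n} {H} {s} {r rs} →
             r ∈ rs → ValidAll ps rs H s →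
             IsCubic G → Inj (u ∷ᶠ f) → Induced G (u ∷ᶠ f) (extend r H) → Reach G λ G′ → Goal G′ (f ∘ s)
    runAll (p ∷ ps) (here refl) (valid , _) cubic inj ind = run p valid cubic inj ind
    runAll (p ∷ ps) (there r∈) (_ , valid) cubic inj ind = runAll ps r∈ valid cubic inj ind

  -- `Valid` computes away, so its arguments could not be recovered from its type; the record keeps
  -- them inferable and lets `correct? _ _ _ _` be solved by unification.
  record Correct {k} (p : Plan Leaf k) (H : Adj k) (s : Fin m → Fin k) : Set where
    constructor correct
    field valid : Valid p H s

  correct? : ∀ {k} (p : Plan Leaf k) H s → Dec (Correct p H s)
  correct? p H s = map′ correct Correct.valid (valid? p H s)

  execute : ∀ {k n} {p : Plan Leaf k} {H s} → Correct p H s → {G : Adj n} {f : Fin k → Fin n} →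
            IsCubic G → Inj f → Induced G f H → Reach G λ G′ → Goal G′ (f ∘ s)
  execute {p = p} (correct valid) = run p valid

open Search using (Correct; correct?; execute)

-- Copies of a pattern, and the two kinds of goal

infix 4 _[_]≅_
record _[_]≅_ {k n} (G : Adj n) (f : Fin k → Fin n) (T : Adj k) : Set where
  constructor copy
  field
    injective : Inj f
    induced : Induced G f T

open _[_]≅_

Occurs : ∀ {k n} → Adj k → Adj n → Set
Occurs T G = ∃[ f ] G [ f ]≅ T

induced? : ∀ {k n} (G : Adj n) (f : Fin k → Fin n) T → Dec (Induced G f T)
induced? G f T = all? λ i → all? λ j → entry G (f i) (f j) ≟ᵇ entry T i j

-- Only existence of some pattern matters here, so no starting vertex is tracked. A leaf names the
-- pattern reached and the known vertices that carry it.
anywhere : ∀ {l} → (Fin l → ∃ Adj) → Target 0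
anywhere Ts = record
  { Leaf = λ k → ∃[ i ] Vec (Fin k) (proj₁ (Ts i))
  ; Hit = λ (i , g) H _ → (∀ a b → lookup g a ≡ lookup g b → a ≡ b) × Induced H (lookup g) (proj₂ (Ts i))
  ; hit? = λ (i , g) H _ →
      (all? λ a → all? λ b → (lookup g a ≟ lookup g b) →-dec (a ≟ b))
        ×-dec induced? H (lookup g) (proj₂ (Ts i))
  ; Goal = λ G _ → ∃[ i ] Occurs (proj₂ (Ts i)) G
  ; hit⇒goal = λ { {f = f} inj ind (i , g) _ (g-inj , hit) →
      i , f ∘ lookup g , copy (λ eq → g-inj _ _ (inj eq)) λ a b → trans (ind _ _) (hit a b) }
  }

-- Here the position matters: `σ` prescribes which starting vertices must carry `T` at the end,
-- however many vertices were explored meanwhile.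
pinned : ∀ {k m} → (Fin k → Fin m) → Adj k → Target m
pinned σ T = record
  { Leaf = λ _ → ⊤
  ; Hit = λ _ H s → Induced H (s ∘ σ) T
  ; hit? = λ _ H s → induced? H (s ∘ σ) T
  ; Goal = λ G h → Induced G (h ∘ σ) T
  ; hit⇒goal = λ inj ind _ s hit a b → trans (ind _ _) (hit a b)
  }

reach-anywhere : ∀ {k l n} (Ts : Fin l → ∃ Adj) {p} {H : Adj k} {s} → Correct (anywhere Ts) p H s →
  {G : Adj n} → IsCubic G → Occurs H G → Reach G λ G′ → ∃[ i ] Occurs (proj₂ (Ts i)) G′
reach-anywhere Ts plan cubic (f , copy inj ind) = execute (anywhere Ts) plan cubic inj ind

reach-pinned : ∀ {k t n} (σ : Fin t → Fin k) T {p H} → Correct (pinned σ T) p H id →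
  {G : Adj n} → IsCubic G → ∀ {f} → G [ f ]≅ H → Reach G λ G′ → Induced G′ (f ∘ σ) T
reach-pinned σ T plan cubic (copy inj ind) = execute (pinned σ T) plan cubic inj ind

-- Reaching a K₄

private
  pattern ○ = false
  pattern ● = true

vertex : Adj 1
vertex = (○ ∷ []) ∷ []

triangle : Adj 3
triangle =
    (○ ∷ ● ∷ ● ∷ [])
  ∷ (● ∷ ○ ∷ ● ∷ [])
  ∷ (● ∷ ● ∷ ○ ∷ [])
  ∷ []

K₄ : Adj 4
K₄ =
    (○ ∷ ● ∷ ● ∷ ● ∷ [])
  ∷ (● ∷ ○ ∷ ● ∷ ● ∷ [])
  ∷ (● ∷ ● ∷ ○ ∷ ● ∷ [])
  ∷ (● ∷ ● ∷ ● ∷ ○ ∷ [])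
  ∷ []

diamond : Adj 4
diamond =
    (○ ∷ ● ∷ ● ∷ ● ∷ [])
  ∷ (● ∷ ○ ∷ ● ∷ ● ∷ [])
  ∷ (● ∷ ● ∷ ○ ∷ ○ ∷ [])
  ∷ (● ∷ ● ∷ ○ ∷ ○ ∷ [])
  ∷ []

prism : Adj 6
prism =
    (○ ∷ ● ∷ ● ∷ ● ∷ ○ ∷ ○ ∷ [])
  ∷ (● ∷ ○ ∷ ● ∷ ○ ∷ ● ∷ ○ ∷ [])
  ∷ (● ∷ ● ∷ ○ ∷ ○ ∷ ○ ∷ ● ∷ [])
  ∷ (● ∷ ○ ∷ ○ ∷ ○ ∷ ● ∷ ● ∷ [])
  ∷ (○ ∷ ● ∷ ○ ∷ ● ∷ ○ ∷ ● ∷ [])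
  ∷ (○ ∷ ○ ∷ ● ∷ ● ∷ ● ∷ ○ ∷ [])
  ∷ []

isolated : ∀ {k} → Adj k → Adj (suc k)
isolated H = extend (replicate _ false) H

only : ∀ {k} → Adj k → Fin 1 → ∃ Adj
only T _ = _ , T

-- The prism has to be an outcome of its own, since it is saturated and a plan cannot explore
-- further from within it.
dense : Fin 3 → ∃ Adj
dense 0F = 4 , K₄
dense 1F = 4 , diamond
dense 2F = 6 , prism

open Target using (Leaf)

-- The following four plans, and prism-table below, were found by computer search.

findTriangle : Plan (Leaf (anywhere (only triangle))) 1
findTriangle =
  explore 0F
    ( explore 0F
        ( stop (0F , 0F ∷ 1F ∷ 2F ∷ [])
        ∷ explore 1F
            ( stop (0F , 0F ∷ 1F ∷ 2F ∷ [])
            ∷ stop (0F , 0F ∷ 2F ∷ 3F ∷ [])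
            ∷ stop (0F , 0F ∷ 1F ∷ 2F ∷ [])
            ∷ explore 0F
                ( make 2F 0F 1F 3F 4F then stop (0F , 0F ∷ 1F ∷ 3F ∷ [])
                ∷ make 4F 0F 1F 3F 2F then stop (0F , 0F ∷ 1F ∷ 3F ∷ [])
                ∷ make 2F 0F 1F 3F 4F then stop (0F , 0F ∷ 1F ∷ 3F ∷ [])
                ∷ explore 0F
                    ( make 1F 0F 3F 4F 5F then stop (0F , 0F ∷ 3F ∷ 4F ∷ [])
                    ∷ stop (0F , 0F ∷ 1F ∷ 2F ∷ [])
                    ∷ make 0F 1F 2F 4F 3F then stop (0F , 1F ∷ 2F ∷ 4F ∷ [])
                    ∷ stop (0F , 0F ∷ 1F ∷ 2F ∷ [])
                    ∷ make 0F 1F 2F 4F 5F then stop (0F , 1F ∷ 2F ∷ 4F ∷ [])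
                    ∷ stop (0F , 0F ∷ 1F ∷ 2F ∷ [])
                    ∷ make 0F 1F 2F 4F 3F then stop (0F , 1F ∷ 2F ∷ 4F ∷ [])
                    ∷ [] )
                ∷ [] )
            ∷ [] )
        ∷ [] )
    ∷ [] )

triangle⇒dense : Plan (Leaf (anywhere dense)) 3
triangle⇒dense =
  explore 0F
    ( stop (0F , 0F ∷ 1F ∷ 2F ∷ 3F ∷ [])
    ∷ stop (1F , 1F ∷ 3F ∷ 0F ∷ 2F ∷ [])
    ∷ stop (1F , 1F ∷ 2F ∷ 0F ∷ 3F ∷ [])
    ∷ explore 2F
        ( stop (1F , 3F ∷ 4F ∷ 0F ∷ 2F ∷ [])
        ∷ stop (1F , 3F ∷ 4F ∷ 0F ∷ 2F ∷ [])
        ∷ explore 0F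
            ( stop (2F , 0F ∷ 1F ∷ 2F ∷ 5F ∷ 4F ∷ 3F ∷ [])
            ∷ make 0F 1F 4F 3F 2F then stop (1F , 3F ∷ 4F ∷ 1F ∷ 5F ∷ [])
            ∷ break 1F 0F 2F 5F 4F then stop (1F , 2F ∷ 4F ∷ 1F ∷ 3F ∷ [])
            ∷ make 0F 1F 2F 3F 5F then stop (1F , 1F ∷ 3F ∷ 2F ∷ 4F ∷ [])
            ∷ [] )
        ∷ explore 4F
            ( make 1F 0F 5F 3F 2F then stop (1F , 3F ∷ 5F ∷ 0F ∷ 4F ∷ [])
            ∷ make 0F 2F 3F 4F 1F then stop (1F , 3F ∷ 4F ∷ 2F ∷ 5F ∷ [])
            ∷ make 0F 1F 4F 3F 2F then stop (1F , 3F ∷ 4F ∷ 1F ∷ 5F ∷ [])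
            ∷ explore 0F
                ( make 2F 0F 1F 6F 4F then make 6F 1F 0F 3F 4F then stop (1F , 4F ∷ 5F ∷ 2F ∷ 6F ∷ [])
                ∷ make 0F 3F 4F 5F 2F then stop (1F , 4F ∷ 5F ∷ 3F ∷ 6F ∷ [])
                ∷ make 0F 2F 5F 4F 3F then stop (1F , 4F ∷ 5F ∷ 2F ∷ 6F ∷ [])
                ∷ make 0F 1F 6F 4F 3F then stop (1F , 4F ∷ 6F ∷ 1F ∷ 5F ∷ [])
                ∷ [] )
            ∷ [] )
        ∷ [] )
    ∷ [] )

diamond⇒K₄ : Plan (Leaf (anywhere (only K₄))) 4
diamond⇒K₄ =
  explore 2F
    ( explore 0F
        ( explore 0F
            ( explore 0F
                ( break 2F 0F 1F 3F 6F then make 6F 1F 2F 3F 7F then stop (0F , 4F ∷ 5F ∷ 6F ∷ 7F ∷ [])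
                ∷ make 0F 1F 2F 3F 6F then make 0F 6F 4F 7F 3F then stop (0F , 4F ∷ 5F ∷ 6F ∷ 7F ∷ [])
                ∷ [] )
            ∷ [] )
        ∷ [] )
    ∷ explore 4F
        ( explore 0F
            ( explore 0F
                ( explore 0F
                    ( make 0F 1F 2F 3F 4F then
                      make 8F 3F 2F 4F 7F then
                      stop (0F , 5F ∷ 6F ∷ 7F ∷ 8F ∷ [])
                    ∷ [] )
                ∷ [] )
            ∷ explore 0F
                ( make 0F 1F 2F 3F 6F then make 6F 0F 3F 2F 7F then stop (0F , 4F ∷ 5F ∷ 6F ∷ 7F ∷ [])
                ∷ make 0F 1F 2F 3F 6F then make 0F 6F 4F 7F 2F then stop (0F , 4F ∷ 5F ∷ 6F ∷ 7F ∷ [])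
                ∷ [] )
            ∷ [] )
        ∷ make 1F 4F 2F 5F 0F then stop (0F , 2F ∷ 3F ∷ 4F ∷ 5F ∷ [])
        ∷ [] )
    ∷ [] )

prism⇒K₄ : Plan (Leaf (anywhere (only K₄))) 7
prism⇒K₄ =
  explore 0F
    ( explore 0F
        ( break 0F 1F 2F 3F 4F then
          make 2F 0F 1F 3F 5F then
          break 0F 1F 3F 4F 7F then
          make 0F 3F 6F 8F 5F then
          stop (0F , 3F ∷ 6F ∷ 7F ∷ 8F ∷ [])
        ∷ break 3F 4F 5F 0F 1F then
          make 0F 4F 3F 6F 8F then
          make 2F 1F 5F 8F 7F then
          make 5F 3F 4F 7F 2F then
          stop (0F , 3F ∷ 4F ∷ 6F ∷ 7F ∷ [])
        ∷ [] )
    ∷ [] )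

findTriangle-correct : Correct (anywhere (only triangle)) findTriangle vertex λ ()
findTriangle-correct = toWitness {a? = correct? _ _ _ _} tt

triangle⇒dense-correct : Correct (anywhere dense) triangle⇒dense triangle λ ()
triangle⇒dense-correct = toWitness {a? = correct? _ _ _ _} tt

diamond⇒K₄-correct : Correct (anywhere (only K₄)) diamond⇒K₄ diamond λ ()
diamond⇒K₄-correct = toWitness {a? = correct? _ _ _ _} tt

-- The extra isolated vertex gives the exploration a place to start. Two further vertices follow,
-- which with it form a path or a triangle away from the prism: hence two branches.
prism⇒K₄-correct : Correct (anywhere (only K₄)) prism⇒K₄ (isolated prism) λ ()
prism⇒K₄-correct = toWitness {a? = correct? _ _ _ _} tt

occurs-vertex : ∀ {n} {G : Adj (suc n)} → IsCubic G → Occurs vertex G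
occurs-vertex cubic = (λ _ → zero) , copy (λ { {zero} {zero} _ → refl }) λ { zero zero → irrefl cubic zero }

occurs-dense : ∀ {n} {G : Adj (suc n)} → IsCubic G → Reach G λ G′ → ∃[ i ] Occurs (proj₂ (dense i)) G′
occurs-dense cubic = continue cubic
  (reach-anywhere (only triangle) findTriangle-correct cubic (occurs-vertex cubic))
  λ { cubic₁ (zero , triangle∈) → reach-anywhere dense triangle⇒dense-correct cubic₁ triangle∈ }

isolated-≅ : ∀ {k n} {G : Adj n} {f : Fin k → Fin n} {H} {u} → IsCubic G → G [ f ]≅ H →
  (∀ a → degree H a ≡ 3) → (∀ i → f i ≢ u) → G [ u ∷ᶠ f ]≅ isolated H
isolated-≅ {k} {G = G} {f} {H} {u} cubic (copy inj ind) full u∉ =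
  copy (∷ᶠ-injective u∉ inj) (extend-induced _ u cubic ind λ i → begin
    entry G u (f i)                      ≡⟨ symm cubic u (f i) ⟩
    entry G (f i) u                      ≡⟨ saturated {G = G} {f} {H} cubic inj ind i (full i) u u∉ ⟩
    false                                ≡⟨ lookup-replicate i false ⟨
    lookup (replicate k false) i ∎)
  where open ≡-Reasoning

K₄-full : ∀ a → degree K₄ a ≡ 3
K₄-full = toWitness {a? = all? λ a → degree K₄ a ≟ⁿ 3} tt

prism-full : ∀ a → degree prism a ≡ 3
prism-full = toWitness {a? = all? λ a → degree prism a ≟ⁿ 3} tt

occurs-isolated : ∀ {k n} {G : Adj n} {H : Adj k} → IsCubic G → Occurs H G → (∀ a → degree H a ≡ 3) →
  k < n → Occurs (isolated H) G
occurs-isolated cubic (f , at) full k<n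
  with count-fresh f (λ _ → true)
         (subst₂ _<_ (sym (count-true λ _ → refl)) (sym (count-true λ _ → refl)) k<n)
... | u , _ , u∉ = u ∷ᶠ f , isolated-≅ cubic at full u∉

-- An injective copy of the prism forces at least 6 vertices; if there are not exactly 6, some
-- vertex lies outside it and `prism⇒K₄` applies.
occurs-K₄ : ∀ {n} {G : Adj (suc n)} → IsCubic G →
  Reach G λ G′ → Occurs K₄ G′ ⊎ (suc n ≡ 6 × Occurs prism G′)
occurs-K₄ {n} cubic = continue cubic (occurs-dense cubic) finish
  where
  Finished : Adj (suc n) → Set
  Finished G′ = Occurs K₄ G′ ⊎ (suc n ≡ 6 × Occurs prism G′)
  finished : ∀ {G} → IsCubic G → ∃[ i ] Occurs (proj₂ (only K₄ i)) G → Reach G Finished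
  finished _ (zero , K₄∈) = stay (inj₁ K₄∈)
  leave-prism : ∀ {G} → IsCubic G → Occurs prism G → Dec (suc n ≡ 6) → Reach G Finished
  leave-prism cubic prism∈ (yes n≡6) = stay (inj₂ (n≡6 , prism∈))
  leave-prism cubic prism∈@(_ , at) (no n≢6) = continue cubic
    (reach-anywhere (only K₄) prism⇒K₄-correct cubic (occurs-isolated cubic prism∈ prism-full
      (≤∧≢⇒< (injective⇒≤ (injective at)) (n≢6 ∘ sym))))
    finished
  finish : ∀ {G} → IsCubic G → ∃[ i ] Occurs (proj₂ (dense i)) G → Reach G Finished
  finish cubic (0F , K₄∈) = stay (inj₁ K₄∈)
  finish cubic (1F , diamond∈) =
    continue cubic (reach-anywhere (only K₄) diamond⇒K₄-correct cubic diamond∈) finished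
  finish cubic (2F , prism∈) = leave-prism cubic prism∈ (suc n ≟ⁿ 6)

-- Relabelling

transpose-self : ∀ {n} (i j : Fin n) → transpose i j i ≡ j
transpose-self i j with i ≟ i
... | yes _ = refl
... | no i≢i = contradiction refl i≢i

transpose-other : ∀ {n} {i j k : Fin n} → k ≢ i → k ≢ j → transpose i j k ≡ k
transpose-other {i = i} {j} {k} k≢i k≢j with k ≟ i
... | yes k≡i = contradiction k≡i k≢i
... | no _ with k ≟ j
...   | yes k≡j = contradiction k≡j k≢j
...   | no _ = refl

transpose-injective : ∀ {n} (i j : Fin n) → Inj (transpose i j)
transpose-injective i j {a} {b} eq =
  trans (sym (transpose-inverse j i)) (trans (cong (transpose j i) eq) (transpose-inverse j i))

-- Plans exchange labels of a pattern, while `Mobile` exchanges vertices of the graph; this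
-- translates between the two.
∘-transpose : ∀ {m n} {f : Fin m → Fin n} → Inj f →
  ∀ i j k → f (transpose i j k) ≡ transpose (f i) (f j) (f k)
∘-transpose {f = f} inj i j k with k ≟ i
... | yes refl = sym (transpose-self (f i) (f j))
... | no k≢i with k ≟ j
...   | no k≢j = sym (transpose-other (k≢i ∘ inj) (k≢j ∘ inj))
...   | yes refl with f k ≟ f i
...     | yes fk≡fi = contradiction (inj fk≡fi) k≢i
...     | no _ with f k ≟ f k
...       | yes _ = refl
...       | no fk≢fk = contradiction refl fk≢fk

-- The vertex `e` may lie inside or outside the copy. Inside, the pattern's labels `i` and that of
-- `e` are exchanged; outside, `e` replaces `f i`.
Mobile : ∀ {k} → ℕ → Adj k → Set
Mobile n T = ∀ {G : Adj n} → IsCubic G → ∀ f → G [ f ]≅ T →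
  ∀ i e → Reach G λ G′ → G′ [ transpose (f i) e ∘ f ]≅ T

≅-cong : ∀ {k n} {G : Adj n} {f g : Fin k → Fin n} {T} → f ≗ g → G [ f ]≅ T → G [ g ]≅ T
≅-cong {G = G} f≗g (copy inj ind) = copy
  (λ {a} {b} eq → inj (trans (f≗g a) (trans eq (sym (f≗g b)))))
  (λ a b → trans (cong₂ (entry G) (sym (f≗g a)) (sym (f≗g b))) (ind a b))

-- The places are corrected one at a time in increasing order, each by a single transposition of the
-- current and the desired vertex.
relocate : ∀ {k n} {T : Adj k} → Mobile n T → ∀ {G} → IsCubic G → Occurs T G →
           ∀ {g : Fin k → Fin n} → Inj g → Reach G λ G′ → G′ [ g ]≅ T
relocate {k} {n} {T} mobile {G} cubic (f₀ , start) {g} g-inj = finish (go k ≤-refl)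
  where
  finish : (Reach G λ G′ → ∃[ f ] G′ [ f ]≅ T × (∀ i → toℕ i < k → f i ≡ g i)) → Reach G λ G′ → G′ [ g ]≅ T
  finish (G′ , path , f , at , agree) = G′ , path , ≅-cong (λ i → agree i (toℕ<n i)) at
  go : ∀ j → j ≤ k → Reach G λ G′ → ∃[ f ] G′ [ f ]≅ T × (∀ i → toℕ i < j → f i ≡ g i)
  go zero _ = G , ε , f₀ , start , λ _ ()
  go (suc j) j<k with go j (≤-trans (n≤1+n j) j<k)
  ... | G₁ , path₁ , f , at , agree
    with mobile (⇝-cubic cubic path₁) f at (fromℕ< j<k) (g (fromℕ< j<k))
  ...   | G₂ , path₂ , at′ = G₂ , path₁ ◅◅ path₂ , _ , at′ , agree′
    where
    a = fromℕ< j<k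
    agree′ : ∀ i → toℕ i < suc j → transpose (f a) (g a) (f i) ≡ g i
    agree′ i i<1+j with m≤n⇒m<n∨m≡n (s≤s⁻¹ i<1+j)
    ... | inj₂ i≡j rewrite toℕ-injective {i = i} {a} (trans i≡j (sym (toℕ-fromℕ< j<k))) =
      transpose-self (f a) (g a)
    -- A place already corrected is not disturbed: its vertex differs from `f a` by injectivity of
    -- `f`, and from `g a` by injectivity of `g`.
    ... | inj₁ i<j = trans
      (transpose-other (i≢a ∘ injective at) (i≢a ∘ g-inj ∘ trans (sym (agree i i<j))))
      (agree i i<j)
      where
      i≢a : i ≢ a
      i≢a refl = <-irrefl (toℕ-fromℕ< j<k) i<j

swap-within : ∀ {k n} (T : Adj k) {plan : Fin k → Fin k → Plan (λ _ → ⊤) k} →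
  (∀ i j → Correct (pinned (transpose i j) T) (plan i j) T id) →
  ∀ {G : Adj n} → IsCubic G → ∀ f → G [ f ]≅ T → ∀ i j → Reach G λ G′ → G′ [ transpose (f i) (f j) ∘ f ]≅ T
swap-within T plans cubic f at i j =
  continue cubic (reach-pinned (transpose i j) T (plans i j) cubic at) λ _ ind →
    stay (≅-cong (∘-transpose (injective at) i j) (copy (transpose-injective i j ∘ injective at) ind))

spanning-mobile : ∀ {n} (T : Adj n) {plan : Fin n → Fin n → Plan (λ _ → ⊤) n} →
  (∀ i j → Correct (pinned (transpose i j) T) (plan i j) T id) → Mobile n T
spanning-mobile T plans cubic f at i e with any? (λ j → f j ≟ e)
... | yes (j , refl) = swap-within T plans cubic f at i j
... | no e∉ = contradiction (injective⇒≤ (∷ᶠ-injective (λ j eq → e∉ (j , eq)) (injective at))) 1+n≰n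

prism-table : Fin 6 → Fin 6 → Plan (λ _ → ⊤) 6
prism-table 0F 1F = break 2F 0F 1F 4F 3F then make 3F 0F 2F 1F 4F then stop tt
prism-table 0F 2F = break 1F 0F 2F 5F 3F then make 3F 0F 1F 2F 5F then stop tt
prism-table 0F 3F = break 1F 0F 2F 4F 3F then make 0F 1F 2F 3F 5F then stop tt
prism-table 0F 4F = break 1F 0F 2F 5F 4F then stop tt
prism-table 0F 5F = break 2F 0F 1F 4F 5F then stop tt
prism-table 1F 2F = break 0F 1F 2F 5F 4F then make 4F 1F 0F 2F 5F then stop tt
prism-table 1F 3F = break 0F 1F 2F 5F 3F then stop tt
prism-table 1F 4F = break 0F 1F 2F 3F 4F then make 1F 0F 2F 4F 5F then stop tt
prism-table 1F 5F = break 2F 0F 1F 5F 3F then stop tt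
prism-table 2F 3F = break 0F 1F 2F 3F 4F then stop tt
prism-table 2F 4F = break 1F 0F 2F 4F 3F then stop tt
prism-table 2F 5F = break 0F 1F 2F 5F 3F then make 2F 0F 1F 5F 4F then stop tt
prism-table 3F 4F = break 2F 0F 1F 4F 3F then make 3F 0F 2F 1F 4F then stop tt
prism-table 3F 5F = break 1F 0F 2F 5F 3F then make 3F 0F 1F 2F 5F then stop tt
prism-table 4F 5F = break 0F 1F 2F 5F 4F then make 4F 1F 0F 2F 5F then stop tt
-- All pairs in increasing order are listed above, and `prism-swap` passes the smaller label first,
-- so from there only the diagonal arrives here.
prism-table _ _ = stop tt

prism-swap : Fin 6 → Fin 6 → Plan (λ _ → ⊤) 6
prism-swap i j = if ⌊ toℕ i <? toℕ j ⌋ then prism-table i j else prism-table j i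

prism-swap-correct : ∀ i j → Correct (pinned (transpose i j) prism) (prism-swap i j) prism id
prism-swap-correct = toWitness {a? = all? λ i → all? λ j → correct? _ _ _ _} tt

-- The vertex 3F outside the K₄ takes over the edges of a to b, c and d one at a time, each time handing
-- one of its own neighbours to a.
K₄-swap : Fin 4 → Plan (λ _ → ⊤) 5
K₄-swap i = explore 0F (explore 1F (last-neighbour ∷ last-neighbour ∷ []) ∷ [])
  where
  a b c d : Fin 8
  -- Once all is explored, 0F, 1F and 2F are the neighbours of 3F and the last four vertices carry
  -- the K₄; `punchIn i` lists the three that stay in it.
  a = 4 ↑ʳ i
  b = 4 ↑ʳ punchIn i 0F
  c = 4 ↑ʳ punchIn i 1F
  d = 4 ↑ʳ punchIn i 2F
  trade : Plan (λ _ → ⊤) 8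
  -- The last exchange is a make move: after the two breaks the edge from `a` to `d` lies in no
  -- triangle, but it ends the path through 0F, 3F, `b`, `d`, `a`.
  trade = break c a b 2F 3F then break d a c 1F 3F then make 0F 3F b d a then stop tt
  last-neighbour : Plan (λ _ → ⊤) 7
  last-neighbour = explore 2F (trade ∷ trade ∷ trade ∷ trade ∷ [])

K₄-swap-correct : ∀ i → Correct (pinned (transpose (suc i) zero ∘ suc) K₄) (K₄-swap i) (isolated K₄) id
K₄-swap-correct = toWitness {a? = all? λ i → correct? _ _ _ _} tt

K₄-symmetric : ∀ i j → Correct (pinned (transpose i j) K₄) (stop tt) K₄ id
K₄-symmetric = toWitness {a? = all? λ i → all? λ j → correct? _ _ _ _} tt

-- If `e` already belongs to the copy, no move is made, K₄ being invariant under every relabelling.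
-- Otherwise saturation makes `e` isolated from the copy, as `K₄-swap` requires.
K₄-mobile : ∀ {n} → Mobile n K₄
K₄-mobile cubic f at i e with any? (λ j → f j ≟ e)
... | yes (j , refl) = swap-within K₄ K₄-symmetric cubic f at i j
... | no e∉ = continue cubic
  (reach-pinned (transpose (suc i) zero ∘ suc) K₄ (K₄-swap-correct i) cubic e∷f) λ _ ind →
  stay (≅-cong (λ a → ∘-transpose (injective e∷f) (suc i) zero (suc a))
    (copy (suc-injective ∘ transpose-injective (suc i) zero ∘ injective e∷f) ind))
  where
  e∷f = isolated-≅ cubic at K₄-full λ j eq → e∉ (j , eq)

-- Splitting off a K₄

data Block {m} : Fin (4 + m) → Set where
  front : ∀ i → Block (i ↑ˡ m)
  back : ∀ j → Block (4 ↑ʳ j)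

block : ∀ {m} (i : Fin (4 + m)) → Block i
block 0F = front 0F
block 1F = front 1F
block 2F = front 2F
block 3F = front 3F
block (suc (suc (suc (suc j)))) = back j

front≢back : ∀ {m} (i : Fin 4) (j : Fin m) → i ↑ˡ m ≢ 4 ↑ʳ j
front≢back 0F j ()
front≢back 1F j ()
front≢back 2F j ()
front≢back 3F j ()

record Split {m} (G : Adj (4 + m)) (H : Adj m) : Set where
  field
    front-K₄ : Induced G (_↑ˡ m) K₄
    back-H : Induced G (4 ↑ʳ_) H
    front-back : ∀ i j → entry G (i ↑ˡ m) (4 ↑ʳ j) ≡ false

open Split

-- No edge joins the blocks because every vertex of the K₄ already has its three neighbours there.
split : ∀ {m} {G : Adj (4 + m)} → IsCubic G → G [ _↑ˡ m ]≅ K₄ → Split G (restrict G (4 ↑ʳ_))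
split {m} {G} cubic (copy inj ind) = record
  { front-K₄ = ind
  ; back-H = restrict-induced G (4 ↑ʳ_)
  ; front-back = λ i j → saturated {G = G} {_↑ˡ m} {K₄} cubic inj ind i
      (K₄-full i) (4 ↑ʳ j) (λ i′ → front≢back i′ j)
  }

back-front : ∀ {m} {G : Adj (4 + m)} {H} → IsCubic G → Split G H →
             ∀ j i → entry G (4 ↑ʳ j) (i ↑ˡ m) ≡ false
back-front cubic s j i = trans (symm cubic _ _) (front-back s i j)

split-cubic : ∀ {m} {G : Adj (4 + m)} {H} → IsCubic G → Split G H → IsCubic H
split-cubic {m} {G} {H} cubic s = record
  { symm = λ i j → trans (sym (back-H s i j)) (trans (symm cubic _ _) (back-H s j i))
  ; irrefl = λ i → trans (sym (back-H s i i)) (irrefl cubic _)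
  ; deg = λ i → trans (sym (degree-back i)) (deg cubic (4 ↑ʳ i))
  }
  where
  degree-back : ∀ i → degree G (4 ↑ʳ i) ≡ degree H i
  degree-back i rewrite back-front cubic s i 0F | back-front cubic s i 1F
                | back-front cubic s i 2F | back-front cubic s i 3F =
    count-cong (back-H s i)

split-unique : ∀ {m} {G G′ : Adj (4 + m)} {H} → IsCubic G → IsCubic G′ → Split G H → Split G′ H → G ≡ G′
split-unique {m} {G} {G′} cubic cubic′ s s′ = adj-ext λ i j → same (block i) (block j)
  where
  same : ∀ {i j} → Block i → Block j → entry G i j ≡ entry G′ i j
  same (front i) (front j) = trans (front-K₄ s i j) (sym (front-K₄ s′ i j))
  same (front i) (back j) = trans (front-back s i j) (sym (front-back s′ i j))
  same (back i) (front j) = trans (back-front cubic s i j) (sym (back-front cubic′ s′ i j))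
  same (back i) (back j) = trans (back-H s i j) (sym (back-H s′ i j))

-- A lifted move names back vertices only, so by `after-away` the rows of the K₄ stay as they are.
split-lift : ∀ {m} {G : Adj (4 + m)} {H H′} → IsCubic G → Split G H → H ⇝ H′ → Reach G λ G′ → Split G′ H′
split-lift {G = G} cubic s ε = G , ε , s
split-lift {m} {G} {H} cubic s (_◅_ {j = H₁} t ts) with fromTriangleSwitch {G = H} {H₁} t
... | mv , legal , refl =
  let G′ , path , s′ = split-lift (after-cubic (relabel (4 ↑ʳ_) mv) legal′ cubic) s₁ ts
  in G′ , triangleSwitch (relabel (4 ↑ʳ_) mv) legal′ ◅ path , s′
  where
  inj : Inj (4 ↑ʳ_)
  inj = ↑ʳ-injective 4 _ _
  legal′ : Legal (relabel (4 ↑ʳ_) mv) G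
  legal′ = relabel-legal mv {G} {4 ↑ʳ_} {H} inj (back-H s) legal
  front-kept : ∀ i j → entry (after (relabel (4 ↑ʳ_) mv) G) (i ↑ˡ m) j ≡ entry G (i ↑ˡ m) j
  front-kept i = after-away mv {G} (front≢back i)
  s₁ : Split (after (relabel (4 ↑ʳ_) mv) G) (after mv H)
  s₁ = record
    { front-K₄ = λ i j → trans (front-kept i _) (front-K₄ s i j)
    ; back-H = after-induced mv {G} {4 ↑ʳ_} {H} inj (back-H s)
    ; front-back = λ i j → trans (front-kept i _) (front-back s i j)
    }

Splits : ∀ {m} → Adj (4 + m) → Set
Splits G = ∃[ H ] IsCubic H × Split G H

reach-split : ∀ {m} {G : Adj (4 + m)} → IsCubic G → Occurs K₄ G → Reach G Splits
reach-split {m} cubic K₄∈ = continue cubic (relocate K₄-mobile cubic K₄∈ (↑ˡ-injective m _ _)) λ cubic₁ at →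
  stay (_ , split-cubic cubic₁ (split cubic₁ at) , split cubic₁ at)

-- Splitting off the K₄ would leave a cubic graph on 2 vertices, where no degree exceeds 2.
¬K₄-on-6 : {G : Adj 6} → IsCubic G → ¬ Occurs K₄ G
¬K₄-on-6 cubic K₄∈ = absurd (reach-split cubic K₄∈)
  where
  absurd : ∀ {G} → Reach G Splits → ⊥
  absurd (_ , _ , H , cubicH , _) = <⇒≱ (s≤s ≤-refl) (subst (_≤ 2) (deg cubicH 0F) (count≤ (entry H 0F)))

-- Joining two cubic graphs, by induction on the number of vertices

meet : ∀ {n} {G G′ : Adj n} {Q Q′} → IsCubic G → IsCubic G′ → Reach G Q → Reach G′ Q′ →
       (∀ {G₁ G₁′} → IsCubic G₁ → IsCubic G₁′ → Q G₁ → Q′ G₁′ → G₁ ⇝ G₁′) → G ⇝ G′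
meet cubic cubic′ (_ , path , q) (_ , path′ , q′) link =
  path ◅◅ link (⇝-cubic cubic path) (⇝-cubic cubic′ path′) q q′ ◅◅ ⇝-sym cubic′ path′

Connected : ∀ {n} → (Adj n → Set) → Set
Connected {n} Q = ∀ {G G′ : Adj n} → IsCubic G → IsCubic G′ → Q G → Q G′ → G ⇝ G′

splits-connected : ∀ {m} → Connected {m} (λ _ → ⊤) → Connected {4 + m} Splits
splits-connected rest cubic cubic′ (H , cubicH , s) (H′ , cubicH′ , s′) =
  meet cubic cubic′ (split-lift cubic s (rest cubicH cubicH′ tt tt)) (stay s′)
    λ c c′ t t′ → subst (_ ⇝_) (split-unique c c′ t t′) ε

K₄-connected : ∀ {m} → Connected {m} (λ _ → ⊤) → Connected {4 + m} (Occurs K₄)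
K₄-connected rest cubic cubic′ K₄∈ K₄∈′ =
  meet cubic cubic′ (reach-split cubic K₄∈) (reach-split cubic′ K₄∈′) (splits-connected rest)

-- The prism spans all 6 vertices, so moving it to the identity placement turns the whole adjacency
-- matrix into `prism` itself.
prism-connected : Connected {6} (Occurs prism)
prism-connected cubic cubic′ prism∈ prism∈′ =
  meet cubic cubic′ (relocate mobile cubic prism∈ {id} id) (relocate mobile cubic′ prism∈′ {id} id)
    λ _ _ at at′ → subst (_ ⇝_) (adj-ext λ i j → trans (induced at i j) (sym (induced at′ i j))) ε
  where
  mobile : Mobile 6 prism
  mobile = spanning-mobile prism prism-swap-correct

connected-from-K₄ : ∀ {n} → Connected {suc n} (Occurs K₄) → Connected {suc n} (λ _ → ⊤)
connected-from-K₄ {n} K₄-case cubic cubic′ _ _ = meet cubic cubic′ (occurs-K₄ cubic) (occurs-K₄ cubic′) link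
  where
  link : Connected (λ G → Occurs K₄ G ⊎ (suc n ≡ 6 × Occurs prism G))
  link c c′ (inj₁ K₄∈) (inj₁ K₄∈′) = K₄-case c c′ K₄∈ K₄∈′
  -- The two normal forms never compete: a prism outcome fixes the size at 6, where no K₄ can occur.
  link c c′ (inj₁ K₄∈) (inj₂ (refl , _)) = contradiction K₄∈ (¬K₄-on-6 c)
  link c c′ (inj₂ (refl , _)) (inj₁ K₄∈′) = contradiction K₄∈′ (¬K₄-on-6 c′)
  link c c′ (inj₂ (refl , prism∈)) (inj₂ (_ , prism∈′)) = prism-connected c c′ prism∈ prism∈′

connected-small : ∀ {n} → suc n < 4 → Connected {suc n} (λ _ → ⊤)
connected-small n<4 = connected-from-K₄ λ _ _ (_ , at) _ →
  contradiction (injective⇒≤ (injective at)) (<⇒≱ n<4)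

-- Each step removes a block of four vertices, hence the four base cases. At 0 there is a single
-- matrix; at 1, 2 and 3 a K₄ does not fit, so its case is vacuous.
connected : ∀ n → Connected {n} (λ _ → ⊤)
connected 0 {[]} {[]} _ _ _ _ = ε
connected 1 = connected-small (s≤s (s≤s z≤n))
connected 2 = connected-small (s≤s (s≤s (s≤s z≤n)))
connected 3 = connected-small ≤-refl
connected (suc (suc (suc (suc m)))) = connected-from-K₄ (K₄-connected (connected m))

theorem1 : (n : ℕ) → 2 ∣ n → 4 ≤ n → (P : Adj n → Adj n → ℚ) →
    IsTriangleSwitchChain n P → Irreducible n P
theorem1 n _ _ P (_ , positive) G G′ cubic cubic′ = steps (cubic⇒ cubic) 
  (connected n (cubic⇒ cubic) (cubic⇒ cubic′) tt tt)
  where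
  -- `PosStep` asks for cubic states at both ends, so cubicity is carried along the path.
  steps : ∀ {G G′} → IsCubic G → G ⇝ G′ → Star (PosStep P) G G′
  steps c ε = ε
  steps {G} c (_◅_ {j = G₁} t ts) =
    (⇒cubic c , ⇒cubic c₁ , positive G G₁ (⇒cubic c) t) ◅ steps c₁ ts
    where c₁ = ⇝-cubic c (t ◅ ε)
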